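{- There exists a deterministic two-party communication protocol that, given an $n$-vertex graph $G$ with maximum degree $\Delta$ whose edges are partitioned (adversarially) between Alice and Bob, finds a $(2\Delta-1)$-edge coloring of $G$ using $O(n)$ bits of communication and completes in $O(1)$ rounds.
   Context: Two-party edge-partition model: $G=(V,E)$ is a finite simple undirected graph with $n$ vertices and maximum degree $\Delta$. The vertex set $V$ and the numbers $n,\Delta$ are known to both parties. The edge set is partitioned adversarially as $E=E_A\sqcup E_B$; Alice receives $E_A$, Bob receives $E_B$. In one round, Alice and Bob may each simultaneously send one message to the other. Communication is the total number of bits exchanged. A $(2\Delta-1)$-edge coloring is an assignment of colors from a fixed set of $2\Delta-1$ colors to the edges of $G$ such that any two edges sharing an endpoint receive different colors. Alice must output the colors of the edges in $E_A$ and Bob those of the edges in $E_B$; together these must form a proper edge coloring of $G$. The hidden constants are absolute (independent of $n$ and $\Delta$). -}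

module Defs where

open import Data.Bool.Base using (Bool; if_then_else_)
open import Data.Fin.Base using (Fin)
open import Data.Fin.Subset using (Subset; _∈_; _∪_; _∩_; ∣_∣; Empty)
open import Data.Fin.Subset.Properties using (_∈?_)
open import Data.List.Base using (List; length; map; allFin)
open import Data.List.Extrema.Nat using (max)
open import Data.Nat.Base using (ℕ; zero; suc; _+_; _<_)
open import Data.Product.Base using (_×_; _,_)
open import Relation.Binary.Definitions using (Symmetric)
open import Relation.Binary.PropositionalEquality.Core using (_≡_; _≢_)
open import Relation.Nullary.Decidable.Core using (does)
open import Relation.Nullary.Negation.Core using (¬_)

record Graph (n : ℕ) : Set where
  field
    neighbours : Fin n → Subset n

  infix 4 _~_
  _~_ : Fin n → Fin n → Set
  u ~ v = v ∈ neighbours u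

  field
    ~-sym    : Symmetric _~_
    ~-irrefl : ∀ u → ¬ (u ~ u)

  degree : Fin n → ℕ
  degree u = ∣ neighbours u ∣

  maxDegree : ℕ
  maxDegree = max 0 (map degree (allFin n))

open Graph public using (neighbours; degree; maxDegree)

-- An edge set on a known vertex set is represented by the spanning graph
-- having those edges.
record IsEdgePartition {n : ℕ} (G G₁ G₂ : Graph n) : Set where
  field
    union    : ∀ u → neighbours G u ≡ neighbours G₁ u ∪ neighbours G₂ u
    disjoint : ∀ u → Empty (neighbours G₁ u ∩ neighbours G₂ u)

-- Only the values at pairs (u , v) that are edges of the graph being coloured
-- are meaningful; colours are natural numbers, {0 , … , k - 1} being the
-- palette of size k.
EdgeColours : ℕ → Set
EdgeColours n = Fin n → Fin n → ℕ

record IsProperEdgeColouring {n : ℕ} (G : Graph n) (k : ℕ) (χ : EdgeColours n) : Set where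
  open Graph G using (_~_)
  field
    undirected : ∀ {u v} → u ~ v → χ u v ≡ χ v u
    in-palette : ∀ {u v} → u ~ v → χ u v < k
    proper     : ∀ {u v w} → u ~ v → u ~ w → v ≢ w → χ u v ≢ χ u w

-- χ₁ on the edges of G₁ and χ₂ on all other pairs.
combine : ∀ {n} → Graph n → EdgeColours n → EdgeColours n → EdgeColours n
combine G₁ χ₁ χ₂ u v = if does (v ∈? neighbours G₁ u) then χ₁ u v else χ₂ u v

Message : Set
Message = List Bool

-- Deterministic two-party protocols with simultaneous messages; X and Y are
-- the parties' inputs, U and V their outputs. A node of the tree is a common
-- transcript, so each message depends only on the sender's input and the
-- earlier rounds, and stopping depends only on the transcript.
data Protocol (X Y U V : Set) : Set where
  output : (X → U) → (Y → V) → Protocol X Y U V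
  round  : (X → Message) → (Y → Message) →
           (Message → Message → Protocol X Y U V) → Protocol X Y U V

module _ {X Y U V : Set} where

  outputs : Protocol X Y U V → X → Y → U × V
  outputs (output f g)     x y = f x , g y
  outputs (round a b next) x y = outputs (next (a x) (b y)) x y

  rounds : Protocol X Y U V → X → Y → ℕ
  rounds (output _ _)     x y = zero
  rounds (round a b next) x y = suc (rounds (next (a x) (b y)) x y)

  communication : Protocol X Y U V → X → Y → ℕ
  communication (output _ _)     x y = zero
  communication (round a b next) x y =
    length (a x) + length (b y) + communication (next (a x) (b y)) x y

EdgeColouringProtocol : ℕ → Set
EdgeColouringProtocol n = Protocol (Graph n) (Graph n) (EdgeColours n) (EdgeColours n)

Solves : ∀ {n} → EdgeColouringProtocol n → (k : ℕ) → (G A B : Graph n) → Set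
Solves P k G A B =
  let χA , χB = outputs P A B in IsProperEdgeColouring G k (combine A χA χB)

{-# OPTIONS --safe #-}

-- Write Δ = K + 1. Each party owns a palette of K colours, and one further colour is
-- shared. From its own graph (of maximum degree at most Δ) a party removes two
-- matchings between vertices of large degree and one matching of edges having an end
-- of degree Δ, in such a way that the rest has its vertices of degree K independent;
-- by Fournier's theorem the rest is coloured with the party's own palette. An edge
-- between two vertices of large degree meets at most one edge of the other party at
-- each end, so one of three fixed colours of the other palette is available, and a few
-- bits per vertex tell which. Every other removed edge has an end of degree Δ, where
-- the other party has no edge, and at its other end x it needs only one colour. A party
-- using less than half of its palette at x offers one of its colours which is free
-- there; without an offer, the shared colour is used. Both parties cannot want the
-- shared colour at x, as their degrees there add up to at most Δ.
-- Offers cost O(n) bits in unary once each party has ordered its palette so that the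
-- first free colours come early on average. For Δ ≤ 3 the palettes are too small for
-- this, but there Bob can colour greedily once he knows all colours at each vertex.
module Submission where

open import Defs

import Algebra.Properties.CommutativeMonoid.Sum as Sum
import Algebra.Properties.Semiring.Sum as SemiringSum
open import Data.Bool.Base using (true; false; if_then_else_)
open import Data.Empty using (⊥)
open import Data.Fin.Base using (Fin; zero; suc; toℕ; fromℕ<; _↑ˡ_)
open import Data.Fin.Permutation using (Permutation; _⟨$⟩ʳ_; _⟨$⟩ˡ_; _∘ₚ_)
import Data.Fin.Permutation as Perm
open import Data.Fin.Properties
  using (_≟_; any?; all?; suc-injective; toℕ<n; toℕ-fromℕ<; toℕ-injective; toℕ-↑ˡ; ↑ˡ-injective; pigeonhole)
open import Data.Fin.Subset using (Subset; _∈_; ∣_∣)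
open import Data.Fin.Subset.Properties using (_∈?_; drop-there; x∈p∪q⁺; x∈p∪q⁻; x∈p∩q⁺)
open import Data.List.Base using ([]; _∷_; length; map; allFin)
open import Data.List.Extrema.Nat using (xs≤max)
open import Data.List.Membership.Propositional.Properties using (∈-map⁺; ∈-allFin)
import Data.List.Relation.Unary.All as All
open import Data.Nat.Base using (ℕ; zero; suc; _+_; _*_; _∸_; _≤_; _<_; z≤n; s≤s; s≤s⁻¹)
import Data.Nat.Properties as ℕ
open import Data.Nat.Solver using (module +-*-Solver)
open import Data.Product.Base using (_×_; _,_; proj₁; proj₂; Σ-syntax; ∃-syntax)
open import Data.Sum.Base using (_⊎_; inj₁; inj₂; [_,_]′)
open import Data.Unit.Base using (⊤; tt)
open import Data.Vec.Base using ([]; _∷_; there)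
open import Function.Base using (_∘_; id)
open import Relation.Binary.Definitions using (tri<; tri≈; tri>)
open import Relation.Binary.PropositionalEquality
  using (_≡_; _≢_; refl; sym; trans; cong; cong₂; subst; ≢-sym; module ≡-Reasoning)
open import Relation.Nullary using (¬_; Dec; yes; no; does; contradiction)
open import Relation.Nullary.Decidable using (_×-dec_; _⊎-dec_; ¬?; decidable-stable)
open import Relation.Unary using (Decidable)

open SemiringSum ℕ.+-*-semiring using (*-distribˡ-sum)
open Sum ℕ.+-0-commutativeMonoid using (sum; sum-permute; ∑-comm; ∑-distrib-+)
open +-*-Solver using (solve; con; _:*_; _:+_; _:=_)

-- The budget is `2 * K + 1` colours, while either party may have vertices of degree `K + 1`;
-- Vizing's theorem with two disjoint palettes could take `2 * K + 4`. So edges must be removed, and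
-- they borrow colours from a party whose colouring is unknown. Where both ends keep at least
-- `K - 1` edges of the rest, at most two edges of the two parties lie outside that rest at either
-- end, one of them being the edge itself. Each end thus blocks at most one colour, and three
-- candidates suffice; these three colours are the reason for asking `K ≥ 3`. The remaining removed
-- edges may have an end `x` of low degree, where the other party can use an almost arbitrary set of
-- colours, and naming a free one could take about log K bits. The ordering of the palette brings
-- this down to a constant on average. A party's decomposition and its message depend on its own
-- graph alone, so both messages can be sent at once and one round is enough.

if-yes : {A P : Set} (P? : Dec P) {x y : A} → P → (if does P? then x else y) ≡ x
if-yes (yes _) _ = refl
if-yes (no ¬p) p = contradiction p ¬p

if-no : {A P : Set} (P? : Dec P) {x y : A} → ¬ P → (if does P? then x else y) ≡ y
if-no (yes p) ¬p = contradiction p ¬p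
if-no (no _)  _  = refl

-- Counting with decidable predicates.

indicator : {P : Set} → Dec P → ℕ
indicator P? = if does P? then 1 else 0

count : ∀ {n} {P : Fin n → Set} → Decidable P → ℕ
count P? = sum (λ i → indicator (P? i))

indicator-yes : {P : Set} (P? : Dec P) → P → indicator P? ≡ 1
indicator-yes P? = if-yes P?

indicator-no : {P : Set} (P? : Dec P) → ¬ P → indicator P? ≡ 0
indicator-no P? = if-no P?

indicator-mono : {P Q : Set} (P? : Dec P) (Q? : Dec Q) → (P → Q) → indicator P? ≤ indicator Q?
indicator-mono (no _)  _       _ = z≤n
indicator-mono (yes p) Q?      f = ℕ.≤-reflexive (sym (indicator-yes Q? (f p)))

indicator≤1 : {P : Set} (P? : Dec P) → indicator P? ≤ 1
indicator≤1 (yes _) = ℕ.≤-refl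
indicator≤1 (no _)  = z≤n

sum-mono : ∀ {n} {f g : Fin n → ℕ} → (∀ i → f i ≤ g i) → sum f ≤ sum g
sum-mono {zero}  f≤g = z≤n
sum-mono {suc n} f≤g = ℕ.+-mono-≤ (f≤g zero) (sum-mono (f≤g ∘ suc))

sum≤n*m : ∀ {n m} {f : Fin n → ℕ} → (∀ i → f i ≤ m) → sum f ≤ n * m
sum≤n*m {zero}  f≤m = z≤n
sum≤n*m {suc n} f≤m = ℕ.+-mono-≤ (f≤m zero) (sum≤n*m (f≤m ∘ suc))

count-full : ∀ {n} {P : Fin n → Set} (P? : Decidable P) → (∀ i → P i) → count P? ≡ n
count-full {zero}  P? p = refl
count-full {suc n} P? p = cong₂ _+_ (indicator-yes (P? zero) (p zero)) (count-full (P? ∘ suc) (p ∘ suc))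

sum-indicator≤ : ∀ {n} {P : Fin n → Set} (P? : Decidable P) → sum (λ i → indicator (P? i)) ≤ n
sum-indicator≤ {n} P? = ℕ.≤-trans (sum≤n*m (λ i → indicator≤1 (P? i))) (ℕ.≤-reflexive (ℕ.*-identityʳ n))

everything? : ∀ {n} → Decidable {A = Fin n} (λ _ → ⊤)
everything? _ = yes tt

count-everything : ∀ n → count (everything? {n}) ≡ n
count-everything n = count-full everything? (λ _ → tt)

_∖?_ : ∀ {n} {P : Fin n → Set} → Decidable P → (x : Fin n) → Decidable (λ i → P i × i ≢ x)
(P? ∖? x) i = P? i ×-dec ¬? (i ≟ x)

count-mono : ∀ {n} {P Q : Fin n → Set} (P? : Decidable P) (Q? : Decidable Q) →
             (∀ i → P i → Q i) → count P? ≤ count Q?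
count-mono P? Q? f = sum-mono (λ i → indicator-mono (P? i) (Q? i) (f i))

count-cong : ∀ {n} {P Q : Fin n → Set} (P? : Decidable P) (Q? : Decidable Q) →
             (∀ i → P i → Q i) → (∀ i → Q i → P i) → count P? ≡ count Q?
count-cong P? Q? f g = ℕ.≤-antisym (count-mono P? Q? f) (count-mono Q? P? g)

count-remove : ∀ {n} {P : Fin n → Set} (P? : Decidable P) {x} → P x →
               count P? ≡ suc (count (P? ∖? x))
count-remove {suc n} P? {zero} px = cong₂ _+_ (indicator-yes (P? zero) px)
  (trans (count-cong (P? ∘ suc) ((P? ∖? zero) ∘ suc) (λ i p → p , λ ()) (λ _ → proj₁))
         (cong (_+ count ((P? ∖? zero) ∘ suc))
               (sym (indicator-no ((P? ∖? zero) zero) (λ p → proj₂ p refl)))))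
count-remove {suc n} P? {suc x} px = trans
  (cong₂ _+_
    (ℕ.≤-antisym (indicator-mono (P? zero) ((P? ∖? suc x) zero) (λ p → p , λ ()))
                 (indicator-mono ((P? ∖? suc x) zero) (P? zero) proj₁))
    (trans (count-remove (P? ∘ suc) px)
           (cong suc (count-cong ((P? ∘ suc) ∖? x) ((P? ∖? suc x) ∘ suc)
                        (λ i (p , i≢x) → p , i≢x ∘ suc-injective)
                        (λ i (p , i≢x) → p , i≢x ∘ cong suc)))))
  (ℕ.+-suc _ _)

-- The map is defined only where `P` holds, as for the map sending a used colour at a vertex to the
-- neighbour it leads to. The induction deletes from `Q` the image of the first element of `P`.
count-inj : ∀ {a b} {P : Fin a → Set} {Q : Fin b → Set} (P? : Decidable P) (Q? : Decidable Q)
            (f : ∀ i → P i → Fin b) → (∀ i p → Q (f i p)) →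
            (∀ i j p q → f i p ≡ f j q → i ≡ j) → count P? ≤ count Q?
count-inj {zero}  P? Q? f f∈Q inj = z≤n
count-inj {suc a} P? Q? f f∈Q inj with P? zero
... | no _  = count-inj (P? ∘ suc) Q? (f ∘ suc) (f∈Q ∘ suc)
                (λ i j p q e → suc-injective (inj (suc i) (suc j) p q e))
... | yes p = subst (suc (count (P? ∘ suc)) ≤_) (sym (count-remove Q? (f∈Q zero p)))
  (s≤s (count-inj (P? ∘ suc) (Q? ∖? f zero p) (f ∘ suc)
    (λ i q → f∈Q (suc i) q , λ e → contradiction (inj (suc i) zero q p e) λ ())
    (λ i j p q e → suc-injective (inj (suc i) (suc j) p q e))))

count-disjoint : ∀ {n} {P Q R : Fin n → Set}
  (P? : Decidable P) (Q? : Decidable Q) (R? : Decidable R) →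
  (∀ i → P i → R i) → (∀ i → Q i → R i) → (∀ i → P i → ¬ Q i) →
  count P? + count Q? ≤ count R?
count-disjoint P? Q? R? P⊆R Q⊆R P#Q = ℕ.≤-trans
  (ℕ.≤-reflexive (sym (∑-distrib-+ (λ i → indicator (P? i)) (λ i → indicator (Q? i)))))
  (sum-mono λ i → one (P? i) (Q? i) (R? i) (P⊆R i) (Q⊆R i) (P#Q i))
  where
  one : {A B C : Set} (a : Dec A) (b : Dec B) (c : Dec C) → (A → C) → (B → C) → (A → ¬ B) →
        indicator a + indicator b ≤ indicator c
  one (yes a) (yes b) c f g h = contradiction b (h a)
  one (yes a) (no _)  c f g h = ℕ.≤-reflexive (sym (indicator-yes c (f a)))
  one (no _)  b       c f g h = indicator-mono b c g

count-cover : ∀ {n} {P Q R : Fin n → Set}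
  (P? : Decidable P) (Q? : Decidable Q) (R? : Decidable R) →
  (∀ i → R i → P i ⊎ Q i) → count R? ≤ count P? + count Q?
count-cover P? Q? R? R⊆P∪Q = ℕ.≤-trans
  (sum-mono λ i → one (P? i) (Q? i) (R? i) (R⊆P∪Q i))
  (ℕ.≤-reflexive (∑-distrib-+ (λ i → indicator (P? i)) (λ i → indicator (Q? i))))
  where
  one : {A B C : Set} (a : Dec A) (b : Dec B) (c : Dec C) → (C → A ⊎ B) →
        indicator c ≤ indicator a + indicator b
  one a b (no _)  f = z≤n
  one a b (yes c) f with f c
  ... | inj₁ x = ℕ.≤-trans (ℕ.≤-reflexive (sym (indicator-yes a x))) (ℕ.m≤m+n _ _)
  ... | inj₂ y = ℕ.≤-trans (ℕ.≤-reflexive (sym (indicator-yes b y))) (ℕ.m≤n+m _ _)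

count-positive : ∀ {n} {P : Fin n → Set} (P? : Decidable P) {x} → P x → 1 ≤ count P?
count-positive P? px = subst (1 ≤_) (sym (count-remove P? px)) (s≤s z≤n)

count-none : ∀ {n} {P : Fin n → Set} (P? : Decidable P) → count P? ≡ 0 → ∀ i → ¬ P i
count-none P? e i p = contradiction (subst (1 ≤_) e (count-positive P? p)) λ ()

count-split : ∀ {n} {P Q : Fin n → Set} (P? : Decidable P) (Q? : Decidable Q) →
              count (λ i → P? i ×-dec Q? i) + count (λ i → P? i ×-dec ¬? (Q? i)) ≡ count P?
count-split {P = P} {Q} P? Q? = ℕ.≤-antisym
  (count-disjoint (λ i → P? i ×-dec Q? i) (λ i → P? i ×-dec ¬? (Q? i)) P?
    (λ _ → proj₁) (λ _ → proj₁) (λ i a b → proj₂ b (proj₂ a)))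
  (count-cover (λ i → P? i ×-dec Q? i) (λ i → P? i ×-dec ¬? (Q? i)) P? split)
  where
  split : ∀ i → P i → P i × Q i ⊎ P i × ¬ Q i
  split i p with Q? i
  ... | yes q = inj₁ (p , q)
  ... | no ¬q = inj₂ (p , ¬q)

-- Graphs and partial edge colourings

record DecGraph (n : ℕ) : Set₁ where
  field
    Adj    : Fin n → Fin n → Set
    adj?   : ∀ u v → Dec (Adj u v)
    symm   : ∀ {u v} → Adj u v → Adj v u
    irrefl : ∀ {u} → ¬ Adj u u

  adj⇒≢ : ∀ {u v} → Adj u v → u ≢ v
  adj⇒≢ a refl = irrefl a

  deg : Fin n → ℕ
  deg u = count (adj? u)

open DecGraph public

-- A partial edge colouring is a family of pairwise disjoint matchings, one for
-- each colour; a matching is the involution exchanging the ends of its edges,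
-- so that mate c u ≡ u says that the colour c is missing at u.
record Colouring {n : ℕ} (k : ℕ) (E : Fin k → Fin n → Fin n → Set) : Set where
  field
    mate       : Fin k → Fin n → Fin n
    involutive : ∀ c u → mate c (mate c u) ≡ u
    disjoint   : ∀ {c d u} → mate c u ≡ mate d u → mate c u ≢ u → c ≡ d
    sound      : ∀ {c u} → mate c u ≢ u → E c u (mate c u)

  Missing : Fin k → Fin n → Set
  Missing c u = mate c u ≡ u

  Covered : Fin n → Fin n → Set
  Covered u v = ∃[ c ] mate c u ≡ v

  covered? : ∀ u v → Dec (Covered u v)
  covered? u v = any? (λ c → mate c u ≟ v)

  swap-mate : ∀ {c u v} → mate c u ≡ v → mate c v ≡ u
  swap-mate {c} {u} refl = involutive c u

open Colouring public

empty : ∀ {n k} {E : Fin k → Fin n → Fin n → Set} → Colouring k E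
empty = record
  { mate       = λ _ u → u
  ; involutive = λ _ _ → refl
  ; disjoint   = λ _ u≢u → contradiction refl u≢u
  ; sound      = λ u≢u → contradiction refl u≢u
  }

module _ {n : ℕ} (σ : Fin n → Fin n) (u v : Fin n) where

  joinPair : Fin n → Fin n
  joinPair x with x ≟ u | x ≟ v
  ... | yes _ | _     = v
  ... | no _  | yes _ = u
  ... | no _  | no _  = σ x

  splitPair : Fin n → Fin n
  splitPair x with x ≟ u | x ≟ v
  ... | yes _ | _     = x
  ... | no _  | yes _ = x
  ... | no _  | no _  = σ x

  joinPair-left : joinPair u ≡ v
  joinPair-left with u ≟ u
  ... | yes _  = refl
  ... | no u≢u = contradiction refl u≢u

  joinPair-right : joinPair v ≡ u
  joinPair-right with v ≟ u | v ≟ v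
  ... | yes e | _      = e
  ... | no _  | yes _  = refl
  ... | no _  | no v≢v = contradiction refl v≢v

  joinPair-else : ∀ {x} → x ≢ u → x ≢ v → joinPair x ≡ σ x
  joinPair-else {x} x≢u x≢v with x ≟ u | x ≟ v
  ... | yes e | _     = contradiction e x≢u
  ... | no _  | yes e = contradiction e x≢v
  ... | no _  | no _  = refl

  splitPair-left : splitPair u ≡ u
  splitPair-left with u ≟ u
  ... | yes _  = refl
  ... | no u≢u = contradiction refl u≢u

  splitPair-right : splitPair v ≡ v
  splitPair-right with v ≟ u | v ≟ v
  ... | yes _ | _      = refl
  ... | no _  | yes _  = refl
  ... | no _  | no v≢v = contradiction refl v≢v

  splitPair-else : ∀ {x} → x ≢ u → x ≢ v → splitPair x ≡ σ x
  splitPair-else {x} x≢u x≢v with x ≟ u | x ≟ v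
  ... | yes e | _     = contradiction e x≢u
  ... | no _  | yes e = contradiction e x≢v
  ... | no _  | no _  = refl

  data Position (x : Fin n) : Set where
    atLeft    : x ≡ u → Position x
    atRight   : x ≡ v → Position x
    elsewhere : x ≢ u → x ≢ v → Position x

  position : ∀ x → Position x
  position x with x ≟ u | x ≟ v
  ... | yes e | _     = atLeft e
  ... | no _  | yes e = atRight e
  ... | no a  | no b  = elsewhere a b

  joinPair-involutive : (∀ x → σ (σ x) ≡ x) → σ u ≡ u → σ v ≡ v →
                        ∀ x → joinPair (joinPair x) ≡ x
  joinPair-involutive inv σu σv x with position x
  ... | atLeft refl  = trans (cong joinPair joinPair-left) joinPair-right
  ... | atRight refl = trans (cong joinPair joinPair-right) joinPair-left
  ... | elsewhere x≢u x≢v =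
    trans (cong joinPair (joinPair-else x≢u x≢v))
          (trans (joinPair-else (λ e → x≢u (trans (sym (inv x)) (trans (cong σ e) σu)))
                                (λ e → x≢v (trans (sym (inv x)) (trans (cong σ e) σv))))
                 (inv x))

  splitPair-involutive : (∀ x → σ (σ x) ≡ x) → σ u ≡ v → ∀ x → splitPair (splitPair x) ≡ x
  splitPair-involutive inv σu x with position x
  ... | atLeft refl  = trans (cong splitPair splitPair-left) splitPair-left
  ... | atRight refl = trans (cong splitPair splitPair-right) splitPair-right
  ... | elsewhere x≢u x≢v =
    trans (cong splitPair (splitPair-else x≢u x≢v))
          (trans (splitPair-else (λ e → x≢v (trans (sym (inv x)) (trans (cong σ e) σu)))
                                 (λ e → x≢u (trans (sym (inv x)) (trans (cong σ e) (trans (cong σ (sym σu)) (inv u))))))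
                 (inv x))

  splitPair-fixed : ∀ {x} → σ x ≡ x → splitPair x ≡ x
  splitPair-fixed {x} σx with position x
  ... | atLeft refl  = splitPair-left
  ... | atRight refl = splitPair-right
  ... | elsewhere x≢u x≢v = trans (splitPair-else x≢u x≢v) σx

module _ {n k : ℕ} {E : Fin k → Fin n → Fin n → Set} where

  updateMate : (Fin k → Fin n → Fin n) → Fin k → (Fin n → Fin n) → Fin k → Fin n → Fin n
  updateMate μ c σ e x with e ≟ c
  ... | yes _ = σ x
  ... | no _  = μ e x

  replaceClass : (C : Colouring k E) (c : Fin k) (σ : Fin n → Fin n) →
                 (∀ x → σ (σ x) ≡ x) →
                 (∀ d x → d ≢ c → σ x ≡ mate C d x → σ x ≡ x) →
                 (∀ x → σ x ≢ x → E c x (σ x)) → Colouring k E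
  replaceClass C c σ inv dis snd = record
    { mate       = updateMate (mate C) c σ
    ; involutive = inv′
    ; disjoint   = λ {d} {e} → dis′ d e
    ; sound      = λ {e} → snd′ e
    }
    where
    inv′ : ∀ e x → updateMate (mate C) c σ e (updateMate (mate C) c σ e x) ≡ x
    inv′ e x with e ≟ c
    ... | yes _ = inv x
    ... | no _  = involutive C e x
    dis′ : ∀ d e {x} → updateMate (mate C) c σ d x ≡ updateMate (mate C) c σ e x →
           updateMate (mate C) c σ d x ≢ x → d ≡ e
    dis′ d e {x} eq ne with d ≟ c | e ≟ c
    ... | yes refl | yes refl = refl
    ... | yes refl | no e≢c   = contradiction (dis e x e≢c eq) ne
    ... | no d≢c   | yes refl = contradiction (trans eq (dis d x d≢c (sym eq))) ne
    ... | no _     | no _     = disjoint C eq ne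
    snd′ : ∀ e {x} → updateMate (mate C) c σ e x ≢ x → E e x (updateMate (mate C) c σ e x)
    snd′ e {x} ne with e ≟ c
    ... | yes refl = snd x ne
    ... | no _     = sound C ne

  updateMate-same : ∀ μ c σ x → updateMate μ c σ c x ≡ σ x
  updateMate-same μ c σ x with c ≟ c
  ... | yes _  = refl
  ... | no c≢c = contradiction refl c≢c

  updateMate-other : ∀ μ c σ {e} x → e ≢ c → updateMate μ c σ e x ≡ μ e x
  updateMate-other μ c σ {e} x e≢c with e ≟ c
  ... | yes e≡c = contradiction e≡c e≢c
  ... | no _    = refl

  record Extends (C : Colouring k E) (c : Fin k) (u v : Fin n) : Set where
    field
      result : Colouring k E
      placed  : mate result c u ≡ v
      kept   : ∀ {e x} → mate C e x ≢ x → mate result e x ≡ mate C e x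
      others : ∀ {e} x → e ≢ c → mate result e x ≡ mate C e x

  opaque
    addEdge : (C : Colouring k E) (c : Fin k) (u v : Fin n) → Missing C c u → Missing C c v →
              ¬ Covered C u v → E c u v → E c v u → Extends C c u v
    addEdge C c u v mu mv ¬cov euv evu = record
      { result = replaceClass C c σ
          (joinPair-involutive (mate C c) u v (involutive C c) mu mv) dis snd
      ; placed  = trans (updateMate-same (mate C) c σ u) (joinPair-left (mate C c) u v)
      ; kept   = λ {e} {x} → kept′ e x
      ; others = λ x → updateMate-other (mate C) c σ x
      }
      where
      σ : Fin n → Fin n
      σ = joinPair (mate C c) u v
      dis : ∀ d x → d ≢ c → σ x ≡ mate C d x → σ x ≡ x
      dis d x d≢c eq with position (mate C c) u v x
      ... | atLeft refl  = contradiction (d , trans (sym eq) (joinPair-left (mate C c) u v)) ¬cov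
      ... | atRight refl = contradiction
        (d , swap-mate C (trans (sym eq) (joinPair-right (mate C c) u v))) ¬cov
      ... | elsewhere x≢u x≢v with mate C c x ≟ x
      ...   | yes e = trans (joinPair-else (mate C c) u v x≢u x≢v) e
      ...   | no ne = contradiction
        (sym (disjoint C (trans (sym (joinPair-else (mate C c) u v x≢u x≢v)) eq) ne)) d≢c
      snd : ∀ x → σ x ≢ x → E c x (σ x)
      snd x ne with position (mate C c) u v x
      ... | atLeft refl  = subst (E c u) (sym (joinPair-left (mate C c) u v)) euv
      ... | atRight refl = subst (E c v) (sym (joinPair-right (mate C c) u v)) evu
      ... | elsewhere x≢u x≢v = subst (E c x) (sym e) (sound C (λ f → ne (trans e f)))
        where
        e : σ x ≡ mate C c x
        e = joinPair-else (mate C c) u v x≢u x≢v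
      kept′ : ∀ e x → mate C e x ≢ x → updateMate (mate C) c σ e x ≡ mate C e x
      kept′ e x ne with e ≟ c
      ... | no _ = refl
      ... | yes refl with position (mate C c) u v x
      ...   | atLeft refl  = contradiction mu ne
      ...   | atRight refl = contradiction mv ne
      ...   | elsewhere x≢u x≢v = joinPair-else (mate C c) u v x≢u x≢v

  record Removal (C : Colouring k E) (c : Fin k) (u v : Fin n) : Set where
    field
      result  : Colouring k E
      left    : Missing result c u
      others  : ∀ {e} x → e ≢ c → mate result e x ≡ mate C e x
      missing : ∀ {x} → Missing C c x → Missing result c x
      rest    : ∀ {x} → x ≢ u → x ≢ v → mate result c x ≡ mate C c x

  opaque
    removeEdge : (C : Colouring k E) (c : Fin k) (u v : Fin n) → mate C c u ≡ v → Removal C c u v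
    removeEdge C c u v uv = record
      { result  = replaceClass C c σ
          (splitPair-involutive (mate C c) u v (involutive C c) uv) dis snd
      ; left    = trans (same u) (splitPair-left (mate C c) u v)
      ; others  = λ x → updateMate-other (mate C) c σ x
      ; missing = λ {x} e → trans (same x) (splitPair-fixed (mate C c) u v e)
      ; rest    = λ {x} a b → trans (same x) (splitPair-else (mate C c) u v a b)
      }
      where
      σ : Fin n → Fin n
      σ = splitPair (mate C c) u v
      same : ∀ x → updateMate (mate C) c σ c x ≡ σ x
      same = updateMate-same (mate C) c σ
      dis : ∀ d x → d ≢ c → σ x ≡ mate C d x → σ x ≡ x
      dis d x d≢c eq with position (mate C c) u v x
      ... | atLeft refl  = splitPair-left (mate C c) u v
      ... | atRight refl = splitPair-right (mate C c) u v
      ... | elsewhere x≢u x≢v with mate C c x ≟ x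
      ...   | yes e = trans (splitPair-else (mate C c) u v x≢u x≢v) e
      ...   | no ne = contradiction
        (sym (disjoint C (trans (sym (splitPair-else (mate C c) u v x≢u x≢v)) eq) ne)) d≢c
      snd : ∀ x → σ x ≢ x → E c x (σ x)
      snd x ne with position (mate C c) u v x
      ... | atLeft refl  = contradiction (splitPair-left (mate C c) u v) ne
      ... | atRight refl = contradiction (splitPair-right (mate C c) u v) ne
      ... | elsewhere x≢u x≢v = subst (E c x) (sym e) (sound C (λ f → ne (trans e f)))
        where
        e : σ x ≡ mate C c x
        e = splitPair-else (mate C c) u v x≢u x≢v

-- A loop over `Fin k`: a goal once reached survives all later steps, so it is enough to reach the
-- goals one after the other. Nested uses give loops over pairs and triples.
saturate : {S : Set} (_⊑_ : S → S → Set) → (∀ {s} → s ⊑ s) →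
  (∀ {s t r} → s ⊑ t → t ⊑ r → s ⊑ r) →
  ∀ k (Goal : Fin k → S → Set) → (∀ i {s t} → s ⊑ t → Goal i s → Goal i t) →
  (∀ i s → ∃[ t ] s ⊑ t × Goal i t) → ∀ s → ∃[ t ] s ⊑ t × (∀ i → Goal i t)
saturate _⊑_ rf tr zero    Goal persist step s = s , rf , λ ()
saturate _⊑_ rf tr (suc k) Goal persist step s
  with step zero s
... | t , s⊑t , g₀
  with saturate _⊑_ rf tr k (Goal ∘ suc) (persist ∘ suc) (step ∘ suc) t
... | r , t⊑r , g = r , tr s⊑t t⊑r , λ { zero → persist zero t⊑r g₀ ; (suc i) → g i }

module _ {n k : ℕ} {E : Fin k → Fin n → Fin n → Set}
         (E? : ∀ c u v → Dec (E c u v)) (E-sym : ∀ {c u v} → E c u v → E c v u) where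

  Settled : Fin k → Fin n → Fin n → Colouring k E → Set
  Settled c u v C = E c u v → Covered C u v ⊎ ¬ Missing C c u ⊎ ¬ Missing C c v

  opaque
    maximalColouring : Σ[ C ∈ Colouring k E ] (∀ c u v → Settled c u v C)
    maximalColouring = C , settled
      where
      _⊑_ : Colouring k E → Colouring k E → Set
      C ⊑ D = ∀ {e x} → mate C e x ≢ x → mate D e x ≡ mate C e x
      tr : ∀ {C D F} → C ⊑ D → D ⊑ F → C ⊑ F
      tr p q ne = trans (q (λ e → ne (trans (sym (p ne)) e))) (p ne)
      persist : ∀ c u v {C D} → (u ≢ v) → C ⊑ D → Settled c u v C → Settled c u v D
      persist c u v {C} {D} u≢v p s e with s e
      ... | inj₁ (d , q)  = inj₁ (d , trans (p (λ r → u≢v (trans (sym r) q))) q)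
      ... | inj₂ (inj₁ m) = inj₂ (inj₁ (λ r → m (trans (sym (p m)) r)))
      ... | inj₂ (inj₂ m) = inj₂ (inj₂ (λ r → m (trans (sym (p m)) r)))
      -- On the diagonal, `Covered C u u` says that some colour is missing at `u`, which later
      -- additions can destroy. These pairs are therefore left out of the loop and settled at the
      -- end.
      Goal : Fin k → Fin n → Fin n → Colouring k E → Set
      Goal c u v C = u ≢ v → Settled c u v C
      step : ∀ c u v C → ∃[ D ] C ⊑ D × Goal c u v D
      step c u v C with E? c u v | covered? C u v | mate C c u ≟ u | mate C c v ≟ v
      ... | no ¬e | _       | _     | _     = C , (λ _ → refl) , λ _ e → contradiction e ¬e
      ... | yes _ | yes cov | _     | _     = C , (λ _ → refl) , λ _ _ → inj₁ cov
      ... | yes _ | no _    | no m  | _     = C , (λ _ → refl) , λ _ _ → inj₂ (inj₁ m)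
      ... | yes _ | no _    | yes _ | no m  = C , (λ _ → refl) , λ _ _ → inj₂ (inj₂ m)
      ... | yes e | no ¬cov | yes a | yes b =
        let open Extends (addEdge C c u v a b ¬cov e (E-sym e)) in
        result , kept , λ _ _ → inj₁ (c , placed)
      goals : ∃[ D ] empty ⊑ D × (∀ c u v → Goal c u v D)
      goals = saturate _⊑_ (λ _ → refl) (λ {C} {D} {F} → tr {C} {D} {F}) k
        (λ c D → ∀ u v → Goal c u v D)
        (λ c {C} {D} p g u v u≢v → persist c u v {C} {D} u≢v p (g u v u≢v))
        (λ c → saturate _⊑_ (λ _ → refl) (λ {C} {D} {F} → tr {C} {D} {F}) n
          (λ u D → ∀ v → Goal c u v D)
          (λ u {C} {D} p g v u≢v → persist c u v {C} {D} u≢v p (g v u≢v))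
          (λ u → saturate _⊑_ (λ _ → refl) (λ {C} {D} {F} → tr {C} {D} {F}) n
            (λ v D → Goal c u v D)
            (λ v {C} {D} p g u≢v → persist c u v {C} {D} u≢v p (g u≢v))
            (λ v → step c u v)))
        empty
      C : Colouring k E
      C = proj₁ goals
      settled : ∀ c u v → Settled c u v C
      settled c u v e with u ≟ v
      ... | no u≢v = proj₂ (proj₂ goals) c u v u≢v e
      ... | yes refl with mate C c u ≟ u
      ...   | yes m = inj₁ (c , m)
      ...   | no ¬m = inj₂ (inj₁ ¬m)


-- Kempe components and Vizing fans

least : {P : ℕ → Set} → (∀ i → Dec (P i)) → ∀ k → P k →
        ∃[ l ] l ≤ k × P l × (∀ j → j < l → ¬ P j)
least P? zero p = 0 , z≤n , p , λ _ ()
least P? (suc k) p with P? 0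
... | yes p₀ = 0 , z≤n , p₀ , λ _ ()
... | no ¬p₀ with least (P? ∘ suc) k p
...   | l , l≤k , q , below = suc l , s≤s l≤k , q ,
        λ { zero _ → ¬p₀ ; (suc j) (s≤s j<l) → below j j<l }

double-injective : ∀ a b → a + a ≡ b + b → a ≡ b
double-injective zero    zero    _ = refl
double-injective (suc a) (suc b) e = cong suc (double-injective a b (ℕ.suc-injective
  (trans (sym (ℕ.+-suc a a)) (trans (ℕ.suc-injective e) (ℕ.+-suc b b)))))

-- The two-coloured component of u, where u misses the colour of α: it is a path,
-- so besides u it contains at most one end, and in particular at most one fixed
-- point of β.
record Component {n : ℕ} (α β : Fin n → Fin n) (u : Fin n) : Set₁ where
  field
    Member  : Fin n → Set
    member? : Decidable Member
    start   : Member u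
    closedˡ : ∀ {x} → Member x → Member (α x)
    closedʳ : ∀ {x} → Member x → Member (β x)
    oneEnd  : ∀ {x y} → Member x → Member y → β x ≡ x → β y ≡ y → x ≡ y

-- The component is the orbit of u under α ∘ β. If suc p is the length of this orbit,
-- then β maps its a-th element to the (p − a)-th one, so that a + a ≡ p at a
-- fixed point.
component : ∀ {n} (α β : Fin n → Fin n) → (∀ x → α (α x) ≡ x) → (∀ x → β (β x) ≡ x) →
            ∀ u → α u ≡ u → Component α β u
component {n} α β α² β² u αu = record
  { Member  = Member
  ; member? = λ x → any? (λ (i : Fin (suc p)) → w (toℕ i) ≟ x)
  ; start   = member z≤n
  ; closedˡ = λ { (i , refl) → closedˡ (toℕ i) (s≤s⁻¹ (toℕ<n i)) }
  ; closedʳ = λ { (i , refl) → closedʳ (toℕ i) (s≤s⁻¹ (toℕ<n i)) }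
  ; oneEnd  = λ { (i , refl) (j , refl) βx βy → cong w (double-injective (toℕ i) (toℕ j)
                  (trans (midpoint (toℕ i) (s≤s⁻¹ (toℕ<n i)) βx)
                         (sym (midpoint (toℕ j) (s≤s⁻¹ (toℕ<n j)) βy)))) }
  }
  where
  w : ℕ → Fin n
  w zero    = u
  w (suc k) = α (β (w k))

  step-injective : ∀ {x y} → α (β x) ≡ α (β y) → x ≡ y
  step-injective {x} {y} e =
    trans (sym (β² x)) (trans (cong β (trans (sym (α² _)) (trans (cong α e) (α² _)))) (β² y))

  cancel : ∀ i d → w i ≡ w (i + d) → w d ≡ u
  cancel zero    d e = sym e
  cancel (suc i) d e = cancel i d (step-injective e)

  returns : ∃[ k ] w (suc k) ≡ u
  returns with pigeonhole (ℕ.n<1+n n) (w ∘ toℕ)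
  ... | i , j , i<j , e with ℕ.m≤n⇒∃[o]m+o≡n i<j
  ...   | d , q = d , cancel (toℕ i) (suc d) (trans e (cong w (trans (sym q) (sym (ℕ.+-suc (toℕ i) d)))))

  period : ∃[ p ] p ≤ proj₁ returns × w (suc p) ≡ u × (∀ j → j < p → w (suc j) ≢ u)
  period = least (λ k → w (suc k) ≟ u) (proj₁ returns) (proj₂ returns)

  p : ℕ
  p = proj₁ period

  reflectˡ : ∀ k l → k + l ≡ suc p → α (w k) ≡ w l
  reflectʳ : ∀ k l → k + l ≡ p → β (w k) ≡ w l
  reflectˡ zero    l refl = trans αu (sym (proj₁ (proj₂ (proj₂ period))))
  reflectˡ (suc k) l e    = trans (α² _) (reflectʳ k l (ℕ.suc-injective e))
  reflectʳ k l e = trans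
    (cong β (trans (sym (α² (w k))) (cong α (reflectˡ k (suc l) (trans (ℕ.+-suc k l) (cong suc e))))))
    (trans (cong β (α² _)) (β² (w l)))

  Member : Fin n → Set
  Member x = ∃[ i ] w (toℕ {suc p} i) ≡ x

  member : ∀ {k} → k ≤ p → Member (w k)
  member k≤p = fromℕ< (s≤s k≤p) , cong w (toℕ-fromℕ< (s≤s k≤p))

  closedˡ : ∀ k → k ≤ p → Member (α (w k))
  closedˡ zero    _   = subst Member (sym αu) (member z≤n)
  closedˡ (suc k) k<p = subst Member
    (sym (reflectˡ (suc k) (p ∸ k) (cong suc (ℕ.m+[n∸m]≡n (ℕ.<⇒≤ k<p))))) (member (ℕ.m∸n≤m p k))

  closedʳ : ∀ k → k ≤ p → Member (β (w k))
  closedʳ k k≤p = subst Member (sym (reflectʳ k (p ∸ k) (ℕ.m+[n∸m]≡n k≤p))) (member (ℕ.m∸n≤m p k))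

  distinct : ∀ {i j} → i < j → j ≤ p → w i ≢ w j
  distinct {i} {j} i<j j≤p e with ℕ.m≤n⇒∃[o]m+o≡n i<j
  ... | d , refl = proj₂ (proj₂ (proj₂ period)) d
    (ℕ.≤-trans (s≤s (ℕ.m≤n+m d i)) j≤p) (cancel i (suc d) (trans e (cong w (sym (ℕ.+-suc i d)))))

  midpoint : ∀ a → a ≤ p → β (w a) ≡ w a → a + a ≡ p
  midpoint a a≤p βw with ℕ.<-cmp a (p ∸ a)
  ... | tri< lt _ _ = contradiction (trans (sym βw) (reflectʳ a (p ∸ a) (ℕ.m+[n∸m]≡n a≤p)))
                        (distinct lt (ℕ.m∸n≤m p a))
  ... | tri≈ _ e _ = trans (cong (a +_) e) (ℕ.m+[n∸m]≡n a≤p)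
  ... | tri> _ _ gt = contradiction (trans (sym (reflectʳ a (p ∸ a) (ℕ.m+[n∸m]≡n a≤p))) βw)
                        (distinct gt a≤p)

module _ {n k : ℕ} {E : Fin n → Fin n → Set} (E-sym : ∀ {u v} → E u v → E v u)
         (E-irrefl : ∀ {u} → ¬ E u u) where

  private
    PlainColouring : Set
    PlainColouring = Colouring k (λ _ → E)

  -- Which colour an edge has is forgotten, since swaps and fans recolour edges that were already
  -- coloured. The diagonal is excluded because there `Covered` means that a colour is missing.
  _≼_ : PlainColouring → PlainColouring → Set
  C ≼ D = ∀ {x y} → x ≢ y → Covered C x y → Covered D x y

  opaque
    -- Swapping outside the component of u leaves the colours at u, and so the fan, in place.
    kempeSwap : (C : PlainColouring) (c d : Fin k) (u : Fin n) (K : Component (mate C d) (mate C c) u) →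
      Σ[ D ∈ PlainColouring ] C ≼ D
        × (∀ e {x} → Component.Member K x → mate D e x ≡ mate C e x)
        × (∀ {x} → ¬ Component.Member K x → mate D d x ≡ mate C c x)
        × (∀ e {x} → e ≢ c → e ≢ d → mate D e x ≡ mate C e x)
    kempeSwap C c d u K = D , covers , inside , outside , unchanged
      where
      open Component K
      τ : Fin k → Fin k
      -- Joining `c` and `d` in the identity gives the transposition of the two colours.
      τ = joinPair id c d
      τ² : ∀ e → τ (τ e) ≡ e
      τ² = joinPair-involutive id c d (λ _ → refl) refl refl
      mate′ : Fin k → Fin n → Fin n
      mate′ e x = if does (member? x) then mate C e x else mate C (τ e) x
      inside : ∀ e {x} → Member x → mate′ e x ≡ mate C e x
      inside e {x} m with member? x
      ... | yes _ = refl
      ... | no ¬m = contradiction m ¬m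
      elsewhere′ : ∀ e {x} → ¬ Member x → mate′ e x ≡ mate C (τ e) x
      elsewhere′ e {x} ¬m with member? x
      ... | yes m = contradiction m ¬m
      ... | no _  = refl
      outside : ∀ {x} → ¬ Member x → mate′ d x ≡ mate C c x
      outside {x} ¬m = trans (elsewhere′ d ¬m) (cong (λ e → mate C e x) (joinPair-right id c d))
      unchanged : ∀ e {x} → e ≢ c → e ≢ d → mate′ e x ≡ mate C e x
      unchanged e {x} e≢c e≢d with member? x
      ... | yes _ = refl
      ... | no _  = cong (λ e → mate C e x) (joinPair-else id c d e≢c e≢d)
      closed : ∀ e {x} → e ≡ c ⊎ e ≡ d → Member (mate C e x) → Member x
      closed e {x} (inj₁ refl) m = subst Member (involutive C e x) (closedʳ m)
      closed e {x} (inj₂ refl) m = subst Member (involutive C e x) (closedˡ m)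
      inv′ : ∀ e x → mate′ e (mate′ e x) ≡ x
      inv′ e x with position id c d e
      ... | elsewhere e≢c e≢d = trans (unchanged e e≢c e≢d)
                                  (trans (cong (mate C e) (unchanged e e≢c e≢d)) (involutive C e x))
      ... | atLeft e≡c  = go (member? x)
        where
        go : Dec (Member x) → mate′ e (mate′ e x) ≡ x
        go (yes m) = trans (cong (mate′ e) (inside e m))
          (trans (inside e (subst (λ e → Member (mate C e x)) (sym e≡c) (closedʳ m))) (involutive C e x))
        go (no ¬m) = trans (cong (mate′ e) (elsewhere′ e ¬m))
          (trans (elsewhere′ e (λ q → ¬m (closed (τ e) (inj₂ (trans (cong τ e≡c) (joinPair-left id c d))) q)))
                 (involutive C (τ e) x))
      ... | atRight e≡d  = go (member? x)
        where
        go : Dec (Member x) → mate′ e (mate′ e x) ≡ x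
        go (yes m) = trans (cong (mate′ e) (inside e m))
          (trans (inside e (subst (λ e → Member (mate C e x)) (sym e≡d) (closedˡ m))) (involutive C e x))
        go (no ¬m) = trans (cong (mate′ e) (elsewhere′ e ¬m))
          (trans (elsewhere′ e (λ q → ¬m (closed (τ e) (inj₁ (trans (cong τ e≡d) (joinPair-right id c d))) q)))
                 (involutive C (τ e) x))
      dis′ : ∀ {e f x} → mate′ e x ≡ mate′ f x → mate′ e x ≢ x → e ≡ f
      dis′ {e} {f} {x} eq ne with member? x
      ... | yes _ = disjoint C eq ne
      ... | no _  = trans (sym (τ² e)) (trans (cong τ (disjoint C eq ne)) (τ² f))
      snd′ : ∀ {e x} → mate′ e x ≢ x → E x (mate′ e x)
      snd′ {e} {x} ne with member? x
      ... | yes _ = sound C ne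
      ... | no _  = sound C ne
      D : PlainColouring
      D = record { mate = mate′ ; involutive = inv′ ; disjoint = dis′ ; sound = snd′ }
      covers : C ≼ D
      covers {x} {y} _ (e , q) = go (member? x)
        where
        go : Dec (Member x) → Covered D x y
        go (yes m) = e , trans (inside e m) q
        go (no ¬m) = τ e , trans (elsewhere′ (τ e) ¬m) (trans (cong (λ e → mate C e x) (τ² e)) q)

  module _ (u : Fin n) where

    -- A fan v 0 , … , v l: the colour M (v i) is missing at v i and is the one of the
    -- edge to v (1 + i); recolouring from the last blade frees M (v (l − 1)) at u.
    foldFan : ∀ l (C : PlainColouring) (M : Fin n → Fin k) (v : ℕ → Fin n) →
      (∀ i → i < l → mate C (M (v i)) u ≡ v (suc i)) →
      (∀ i → i ≤ l → Missing C (M (v i)) (v i)) → Missing C (M (v l)) u →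
      (∀ i → i ≤ l → E u (v i)) → ¬ Covered C u (v 0) →
      ∃[ D ] C ≼ D × Covered D u (v 0)
    foldFan zero C M v next miss missu adj ¬cov =
      result , (λ { x≢y (e , q) → e , trans (kept (λ r → x≢y (trans (sym r) q))) q }) , _ , placed
      where open Extends (addEdge C (M (v 0)) u (v 0) missu (miss 0 z≤n) ¬cov (adj 0 z≤n) (E-sym (adj 0 z≤n)))
    foldFan (suc l) C M v next miss missu adj ¬cov =
      let F , D≼F , cov = foldFan l D M v next′ miss′ missu′ (λ i i≤l → adj i (ℕ.m≤n⇒m≤1+n i≤l)) ¬cov′
      in F , (λ x≢y q → D≼F x≢y (C≼D x≢y q)) , cov
      where
      x = v (suc l)
      c = M (v l)
      d = M x
      ux : mate C c u ≡ x
      ux = next l ℕ.≤-refl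
      blade≢u : ∀ i → i ≤ suc l → v i ≢ u
      blade≢u i i≤l e = E-irrefl (subst (E u) e (adj i i≤l))
      used : ∀ i → i < suc l → ¬ Missing C (M (v i)) u
      used i i<l m = blade≢u (suc i) i<l (trans (sym (next i i<l)) m)
      ≢d : ∀ i → i < suc l → M (v i) ≢ d
      ≢d i i<l e = used i i<l (subst (λ f → Missing C f u) (sym e) missu)
      d≢c : d ≢ c
      d≢c = ≢-sym (≢d l ℕ.≤-refl)
      open Removal (removeEdge C c u x ux) using () renaming
        (result to R ; left to left′ ; others to others′ ; missing to missing′ ; rest to rest′)
      ¬covR : ¬ Covered R u x
      ¬covR (e , q) with e ≟ c
      ... | yes refl = blade≢u (suc l) ℕ.≤-refl (trans (sym q) left′)
      ... | no e≢c   = e≢c (disjoint C (trans (sym (others′ u e≢c)) (trans q (sym ux)))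
          (λ r → blade≢u (suc l) ℕ.≤-refl (trans (sym q) (trans (others′ u e≢c) r))))
      open Extends (addEdge R d u x (trans (others′ u d≢c) missu)
        (trans (others′ x d≢c) (miss (suc l) ℕ.≤-refl)) ¬covR (adj (suc l) ℕ.≤-refl) (E-sym (adj (suc l) ℕ.≤-refl)))
        renaming (result to D)
      keep : ∀ {e y z} → y ≢ z → mate R e y ≡ z → Covered D y z
      keep {e} y≢z q = e , trans (kept (λ r → y≢z (trans (sym r) q))) q
      C≼D : C ≼ D
      C≼D {y} {z} y≢z (e , q) with e ≟ c
      ... | no e≢c = keep y≢z (trans (others′ y e≢c) q)
      ... | yes refl with position id u x y
      ...   | atLeft refl    = d , trans placed (trans (sym ux) q)
      ...   | atRight refl   = d , trans (swap-mate D placed) (trans (sym (swap-mate C ux)) q)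
      ...   | elsewhere a b  = keep y≢z (trans (rest′ a b) q)
      next′ : ∀ i → i < l → mate D (M (v i)) u ≡ v (suc i)
      next′ i i<l = trans (others u (≢d i (ℕ.m≤n⇒m≤1+n i<l)))
        (trans (others′ u ≢c) (next i (ℕ.m≤n⇒m≤1+n i<l)))
        where
        -- If `M (v i)` were `c`, the blade after `v i` would already be `x`, whose colour `d` is
        -- missing at `u`; but each blade before the last has its colour in use at `u`.
        ≢c : M (v i) ≢ c
        ≢c e = used (suc i) (s≤s i<l) (subst (λ y → Missing C (M y) u) (sym same) missu)
          where
          same : v (suc i) ≡ x
          same = trans (sym (next i (ℕ.m≤n⇒m≤1+n i<l))) (trans (cong (λ f → mate C f u) e) ux)
      miss′ : ∀ i → i ≤ l → Missing D (M (v i)) (v i)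
      miss′ i i≤l with M (v i) ≟ c
      ... | yes e = trans (others (v i) (≢d i (s≤s i≤l)))
                      (subst (λ f → Missing R f (v i)) (sym e)
                        (missing′ (subst (λ f → Missing C f (v i)) e (miss i (ℕ.m≤n⇒m≤1+n i≤l)))))
      ... | no ≢c = trans (others (v i) (≢d i (s≤s i≤l)))
                      (trans (others′ (v i) ≢c) (miss i (ℕ.m≤n⇒m≤1+n i≤l)))
      missu′ : Missing D c u
      missu′ = trans (others u (≢-sym d≢c)) left′
      ¬cov′ : ¬ Covered D u (v 0)
      ¬cov′ (e , q) with e ≟ d
      ... | yes refl = ¬cov (c , trans ux (trans (sym placed) q))
      ... | no e≢d with e ≟ c
      ...   | yes refl = blade≢u 0 z≤n (trans (sym q) (trans (others u e≢d) left′))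
      ...   | no e≢c   = ¬cov (e , trans (sym (others′ u e≢c)) (trans (sym (others u e≢d)) q))

    -- Vizing's fan argument around `u`: follow from each blade the edge at `u` that has the blade's
    -- missing colour. If some such colour is missing at `u`, the fan folds. Otherwise the fan
    -- repeats, which yields two different blades with the same missing colour `c`. The component of
    -- `u` in the colours `c` and `d` contains at most one of them, and a Kempe swap outside it
    -- makes the other one miss `d`, as `u` does.
    extendColouring : (C : PlainColouring) (v : Fin n) → E u v →
      (∃[ c ] Missing C c u) → (∀ {w} → E u w → ∃[ c ] Missing C c w) →
      ∃[ D ] C ≼ D × Covered D u v
    extendColouring C v₀ uv₀ (d , du) missing with covered? C u v₀
    ... | yes cov = C , (λ _ q → q) , cov
    ... | no ¬cov = go (any? (λ (i : Fin (suc n)) → mate C (M (v (toℕ i))) u ≟ u))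
      where
      pick : ∀ w → Dec (∃[ c ] Missing C c w) → Fin k
      pick w (yes (c , _)) = c
      pick w (no _)        = d
      pick-missing : ∀ w p → E u w → Missing C (pick w p) w
      pick-missing w (yes (_ , q)) _ = q
      pick-missing w (no ¬p)       a = contradiction (missing a) ¬p
      M : Fin n → Fin k
      M w = pick w (any? (λ c → mate C c w ≟ w))
      M-missing : ∀ w → E u w → Missing C (M w) w
      M-missing w = pick-missing w (any? (λ c → mate C c w ≟ w))
      v : ℕ → Fin n
      v zero    = v₀
      v (suc i) = mate C (M (v i)) u
      adj : ∀ l → (∀ j → j < l → ¬ Missing C (M (v j)) u) → ∀ i → i ≤ l → E u (v i)
      adj l busy zero    _   = uv₀
      adj l busy (suc i) i<l = sound C (busy i i<l)

      -- Equal blades are joined to `u` by the same edge, hence by the same colour, so their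
      -- predecessors miss a common colour. If the predecessors coincide, step back; the descent
      -- cannot end at `v 0`, because its edge to `u` is uncoloured.
      twins : ∀ i j → i < j → j ≤ n → (∀ l → l ≤ n → ¬ Missing C (M (v l)) u) → v i ≡ v j →
              ∃[ a ] ∃[ b ] a ≤ n × b ≤ n × v a ≢ v b × M (v a) ≡ M (v b)
      twins zero    (suc j) _         j<n busy e = contradiction (M (v j) , sym e) ¬cov
      twins (suc i) (suc j) (s≤s i<j) j<n busy e with v i ≟ v j
      ... | yes e′ = twins i j i<j (ℕ.<⇒≤ j<n) busy e′
      ... | no ne  = i , j , ℕ.≤-trans (ℕ.<⇒≤ i<j) (ℕ.<⇒≤ j<n) , ℕ.<⇒≤ j<n , ne ,
                     disjoint C e (busy i (ℕ.≤-trans (ℕ.<⇒≤ i<j) (ℕ.<⇒≤ j<n)))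

      -- The blade `v z` lies outside the component of `u`, so after the swap it misses `d` in place
      -- of `c`, while the colours at `u` have not moved. `M′` records the new missing colours.
      rotate : (∀ l → l ≤ n → ¬ Missing C (M (v l)) u) → ∀ c →
               (K : Component (mate C d) (mate C c) u) →
               ∀ z → z ≤ n → M (v z) ≡ c → ¬ Component.Member K (v z) →
               ∃[ D ] C ≼ D × Covered D u v₀
      rotate busy c K z z≤n′ Mz≡c z∉K =
        let F , D≼F , cov = foldFan l D M′ v next miss missu
                              (λ i i≤l → adj n (λ j j<n → busy j (ℕ.<⇒≤ j<n)) i (ℕ.≤-trans i≤l l≤n)) ¬covD
        in F , (λ x≢y q → D≼F x≢y (C≼D x≢y q)) , cov
        where
        open Component K
        swapped = kempeSwap C c d u K
        D = proj₁ swapped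
        C≼D : C ≼ D
        C≼D = proj₁ (proj₂ swapped)
        inside : ∀ e {x} → Member x → mate D e x ≡ mate C e x
        inside = proj₁ (proj₂ (proj₂ swapped))
        outside : ∀ {x} → ¬ Member x → mate D d x ≡ mate C c x
        outside = proj₁ (proj₂ (proj₂ (proj₂ swapped)))
        unchanged : ∀ e {x} → e ≢ c → e ≢ d → mate D e x ≡ mate C e x
        unchanged = proj₂ (proj₂ (proj₂ (proj₂ swapped)))
        M′ : Fin n → Fin k
        M′ w with member? w | M w ≟ c
        ... | no _  | yes _ = d
        ... | no _  | no _  = M w
        ... | yes _ | _     = M w
        M′-new : ∀ w → ¬ Member w → M w ≡ c → M′ w ≡ d
        M′-new w ¬m e with member? w | M w ≟ c
        ... | yes m | _     = contradiction m ¬m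
        ... | no _  | yes _ = refl
        ... | no _  | no ne = contradiction e ne
        M′-cases : ∀ w → M′ w ≡ d ⊎ M′ w ≡ M w
        M′-cases w with member? w | M w ≟ c
        ... | no _  | yes _ = inj₁ refl
        ... | no _  | no _  = inj₂ refl
        ... | yes _ | _     = inj₂ refl
        Dd : Missing D d u
        Dd = trans (inside d start) du
        missing′ : ∀ i → i ≤ n → E u (v i) → Missing D (M′ (v i)) (v i)
        missing′ i i≤n a with member? (v i) | M (v i) ≟ c
        ... | yes m | _     = trans (inside _ m) (M-missing (v i) a)
        ... | no ¬m | yes e = trans (outside ¬m)
                                (subst (λ f → Missing C f (v i)) e (M-missing (v i) a))
        ... | no ¬m | no ne = trans
          (unchanged _ ne (λ e → busy i i≤n (subst (λ f → Missing C f u) (sym e) du)))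
          (M-missing (v i) a)
        -- Blades before `v z` may have turned to `d` as well. Cutting at the first blade whose new
        -- colour is missing at `u` leaves only earlier blades that keep their old colour, hence
        -- intact links.
        first = least (λ i → mate D (M′ (v i)) u ≟ u) z
          (subst (λ f → Missing D f u) (sym (M′-new (v z) z∉K Mz≡c)) Dd)
        l = proj₁ first
        l≤n : l ≤ n
        l≤n = ℕ.≤-trans (proj₁ (proj₂ first)) z≤n′
        missu : Missing D (M′ (v l)) u
        missu = proj₁ (proj₂ (proj₂ first))
        next : ∀ i → i < l → mate D (M′ (v i)) u ≡ v (suc i)
        next i i<l with M′-cases (v i)
        ... | inj₁ e = contradiction (subst (λ f → Missing D f u) (sym e) Dd)
                         (proj₂ (proj₂ (proj₂ first)) i i<l)
        ... | inj₂ e = trans (inside _ start) (cong (λ f → mate C f u) e)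
        miss : ∀ i → i ≤ l → Missing D (M′ (v i)) (v i)
        miss i i≤l = missing′ i (ℕ.≤-trans i≤l l≤n)
          (adj n (λ j j<n → busy j (ℕ.<⇒≤ j<n)) i (ℕ.≤-trans i≤l l≤n))
        ¬covD : ¬ Covered D u v₀
        ¬covD (e , q) = ¬cov (e , trans (sym (inside e start)) q)

      go : Dec (∃[ i ] Missing C (M (v (toℕ {suc n} i))) u) → ∃[ D ] C ≼ D × Covered D u v₀
      go (yes (i , m)) with least (λ i → mate C (M (v i)) u ≟ u) (toℕ i) m
      ... | l , _ , missu , busy = foldFan l C M v (λ _ _ → refl)
              (λ i i≤l → M-missing (v i) (adj l busy i i≤l)) missu (adj l busy) ¬cov
      go (no busy) = clash (pigeonhole (ℕ.n<1+n n) (v ∘ toℕ))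
        where
        busy′ : ∀ l → l ≤ n → ¬ Missing C (M (v l)) u
        busy′ l l≤n m = busy (fromℕ< (s≤s l≤n) ,
          subst (λ l → Missing C (M (v l)) u) (sym (toℕ-fromℕ< (s≤s l≤n))) m)
        clash : (∃[ i ] ∃[ j ] (toℕ {suc n} i < toℕ {suc n} j × v (toℕ i) ≡ v (toℕ j))) →
                ∃[ D ] C ≼ D × Covered D u v₀
        clash (i , j , i<j , e) with twins (toℕ i) (toℕ j) i<j (s≤s⁻¹ (toℕ<n j)) busy′ e
        ... | a , b , a≤n , b≤n , va≢vb , same = choose (member? (v a)) (member? (v b))
          where
          K : Component (mate C d) (mate C (M (v a))) u
          K = component (mate C d) (mate C (M (v a))) (involutive C d) (involutive C (M (v a))) u du
          open Component K
          adj′ : ∀ i → i ≤ n → E u (v i)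
          adj′ = adj n (λ j j<n → busy′ j (ℕ.<⇒≤ j<n))
          choose : Dec (Member (v a)) → Dec (Member (v b)) → ∃[ D ] C ≼ D × Covered D u v₀
          choose (no a∉K)  _        = rotate busy′ (M (v a)) K a a≤n refl a∉K
          choose (yes _)   (no b∉K) = rotate busy′ (M (v a)) K b b≤n (sym same) b∉K
          choose (yes a∈K) (yes b∈K) = contradiction
            (oneEnd a∈K b∈K (M-missing (v a) (adj′ a a≤n))
              (subst (λ f → Missing C f (v b)) (sym same) (M-missing (v b) (adj′ b b≤n)))) va≢vb

-- Fournier's theorem and the decomposition of a party's graph

covered-sym : ∀ {n k} {E : Fin k → Fin n → Fin n → Set} (C : Colouring k E) {u v} →
              Covered C u v → Covered C v u
covered-sym C (c , e) = c , swap-mate C e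

used? : ∀ {n k} {E : Fin k → Fin n → Fin n → Set} (C : Colouring k E) (v : Fin n) →
        Decidable (λ c → ¬ Missing C c v)
used? C v c = ¬? (mate C c v ≟ v)

module _ {n k : ℕ} (G : DecGraph n) {E : Fin k → Fin n → Fin n → Set}
         (E⊆G : ∀ {c u v} → E c u v → Adj G u v) (C : Colouring k E) where

  used≤deg : ∀ v → count (used? C v) ≤ deg G v
  used≤deg v = count-inj (used? C v) (adj? G v) (λ c _ → mate C c v) (λ c m → E⊆G (sound C m))
    (λ c d m _ e → disjoint C e m)

  -- The mates of `u` are distinct neighbours, and `v` is not among them.
  used<deg : ∀ {u v} → Adj G u v → ¬ Covered C u v → count (used? C u) < deg G u
  used<deg {u} {v} a ¬cov = ℕ.≤-trans
    (s≤s (count-inj (used? C u) (adj? G u ∖? v) (λ c _ → mate C c u)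
      (λ c m → E⊆G (sound C m) , λ e → ¬cov (c , e)) (λ c d m _ e → disjoint C e m)))
    (ℕ.≤-reflexive (sym (count-remove (adj? G u) a)))

  exists-missing : ∀ v → count (used? C v) < k → ∃[ c ] Missing C c v
  exists-missing v lt with any? (λ c → mate C c v ≟ v)
  ... | yes m = m
  ... | no ¬m = contradiction lt (ℕ.<-irrefl (count-full (used? C v) (λ c m → ¬m (c , m))))

Total : ∀ {n k} (G : DecGraph n) → Colouring k (λ _ → Adj G) → Set
Total G C = ∀ {u v} → Adj G u v → Covered C u v

opaque
  -- Every fan is centred at a vertex of `P`. The centre misses a colour because one of its at most
  -- `k` edges is still uncoloured, and its neighbours miss one because their degree is below `k`.
  extendAt : ∀ {n k} (G : DecGraph n) (C : Colouring k (λ _ → Adj G)) {P : Fin n → Set} →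
    Decidable P → (∀ u → deg G u ≤ k) → (∀ {u w} → P u → Adj G u w → deg G w < k) →
    Σ[ D ∈ Colouring k (λ _ → Adj G) ] (∀ {x y} → x ≢ y → Covered C x y → Covered D x y)
           × (∀ {u v} → P u → Adj G u v → Covered D u v)
  extendAt {n} {k} G C {P} P? deg≤k deg<k = D , C≼D , λ p a → done _ _ p a
    where
    _⊑_ : (C D : Colouring k (λ _ → Adj G)) → Set
    C ⊑ D = ∀ {x y} → x ≢ y → Covered C x y → Covered D x y
    Goal : (u v : Fin n) → Colouring k (λ _ → Adj G) → Set
    Goal u v C = P u → Adj G u v → Covered C u v
    step : ∀ u v C → ∃[ D ] C ⊑ D × Goal u v D
    step u v C with P? u | adj? G u v | covered? C u v
    ... | no ¬p | _      | _       = C , (λ _ q → q) , λ p → contradiction p ¬p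
    ... | yes _ | no ¬a  | _       = C , (λ _ q → q) , λ _ a → contradiction a ¬a
    ... | yes _ | yes _  | yes cov = C , (λ _ q → q) , λ _ _ → cov
    ... | yes p | yes a  | no ¬cov with extendColouring (symm G) (irrefl G) u C v a
          (exists-missing G id C u (ℕ.≤-trans (used<deg G id C a ¬cov) (deg≤k u)))
          (λ {w} b → exists-missing G id C w (ℕ.≤-trans (s≤s (used≤deg G id C w)) (deg<k p b)))
    ...   | F , C⊑F , cov = F , (λ {x} {y} → C⊑F {x} {y}) , λ _ _ → cov
    goals : ∃[ D ] C ⊑ D × (∀ u v → Goal u v D)
    goals = saturate _⊑_ (λ _ q → q) (λ f g ne q → g ne (f ne q)) n
      (λ u D → ∀ v → Goal u v D)
      (λ u f g v p a → f (adj⇒≢ G a) (g v p a))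
      (λ u → saturate _⊑_ (λ _ q → q) (λ f g ne q → g ne (f ne q)) n
        (λ v D → Goal u v D)
        (λ v f g p a → f (adj⇒≢ G a) (g p a))
        (step u))
      C
    D : Colouring k (λ _ → Adj G)
    D = proj₁ goals
    C≼D : C ⊑ D
    C≼D = proj₁ (proj₂ goals)
    done : ∀ u v → P u → Adj G u v → Covered D u v
    done = proj₂ (proj₂ goals)

weaken : ∀ {n k} {E F : Fin k → Fin n → Fin n → Set} → (∀ {c u v} → E c u v → F c u v) →
         Colouring k E → Colouring k F
weaken E⊆F C = record
  { mate = mate C ; involutive = involutive C ; disjoint = disjoint C ; sound = λ m → E⊆F (sound C m) }

-- A case of Fournier's theorem. The edges between vertices of degree less than k are
-- coloured first; a remaining edge is then extended from its end of degree k, all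
-- of whose neighbours miss a colour.
opaque
  fournier : ∀ {n k} (G : DecGraph n) → (∀ u → deg G u ≤ k) →
    (∀ {u v} → Adj G u v → deg G u ≡ k → deg G v < k) →
    Σ[ C ∈ Colouring k (λ _ → Adj G) ] Total G C
  fournier {n} {k} G deg≤k independent = proj₁ second , λ {u} {v} → total u v
    where
    H : DecGraph n
    H = record
      { Adj    = λ u v → Adj G u v × deg G u < k × deg G v < k
      ; adj?   = λ u v → adj? G u v ×-dec deg G u ℕ.<? k ×-dec deg G v ℕ.<? k
      ; symm   = λ (a , p , q) → symm G a , q , p
      ; irrefl = λ (a , _) → irrefl G a
      }
    degH≤ : ∀ u → deg H u ≤ deg G u
    degH≤ u = count-mono (adj? H u) (adj? G u) (λ _ → proj₁)
    first : Σ[ D ∈ Colouring k (λ _ → Adj H) ]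
                   (∀ {x y} → x ≢ y → Covered (empty {k = k} {E = λ _ → Adj H}) x y → Covered D x y)
                   × (∀ {u v} → ⊤ → Adj H u v → Covered D u v)
    first = extendAt {k = k} H empty {λ _ → ⊤} (λ _ → yes tt) (λ u → ℕ.≤-trans (degH≤ u) (deg≤k u))
      (λ {_} {w} _ (_ , _ , q) → ℕ.≤-trans (s≤s (degH≤ w)) q)
    C : Colouring k (λ _ → Adj G)
    C = weaken proj₁ (proj₁ first)
    second : Σ[ D ∈ Colouring k (λ _ → Adj G) ] (∀ {x y} → x ≢ y → Covered C x y → Covered D x y)
                    × (∀ {u v} → deg G u ≡ k → Adj G u v → Covered D u v)
    second = extendAt G C {λ u → deg G u ≡ k} (λ u → deg G u ℕ.≟ k) deg≤k
      (λ p a → independent a p)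
    total : ∀ u v → Adj G u v → Covered (proj₁ second) u v
    total u v a with deg G u ℕ.≟ k | deg G v ℕ.≟ k
    ... | yes p | _     = proj₂ (proj₂ second) p a
    ... | no _  | yes q = covered-sym (proj₁ second) (proj₂ (proj₂ second) q (symm G a))
    ... | no p  | no q  = proj₁ (proj₂ second) (adj⇒≢ G a)
      (proj₂ (proj₂ first) tt (a , ℕ.≤∧≢⇒< (deg≤k u) p , ℕ.≤∧≢⇒< (deg≤k v) q))

record Matching {n} (G : DecGraph n) : Set where
  field
    partner   : Fin n → Fin n
    partner²  : ∀ u → partner (partner u) ≡ u
    isEdge    : ∀ {u} → partner u ≢ u → Adj G u (partner u)

open Matching public

_∖_ : ∀ {n} (G : DecGraph n) → Matching G → DecGraph n
G ∖ M = record
  { Adj    = λ u v → Adj G u v × partner M u ≢ v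
  ; adj?   = λ u v → adj? G u v ×-dec ¬? (partner M u ≟ v)
  ; symm   = λ {u} (a , ne) → symm G a , λ e → ne (trans (cong (partner M) (sym e)) (partner² M _))
  ; irrefl = λ (a , _) → irrefl G a
  }

module _ {n} (G : DecGraph n) (M : Matching G) where

  deg-unmatched : ∀ {u} → partner M u ≡ u → deg (G ∖ M) u ≡ deg G u
  deg-unmatched {u} e = count-cong (adj? (G ∖ M) u) (adj? G u) (λ _ → proj₁)
    (λ v a → a , λ f → adj⇒≢ G a (trans (sym e) f))

  deg-matched : ∀ {u} → partner M u ≢ u → deg G u ≡ suc (deg (G ∖ M) u)
  deg-matched {u} ne = trans (count-remove (adj? G u) (isEdge M ne))
    (cong suc (count-cong (adj? G u ∖? partner M u) (adj? (G ∖ M) u)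
      (λ v (a , f) → a , ≢-sym f) (λ v (a , f) → a , ≢-sym f)))

  deg-∖≤ : ∀ u → deg (G ∖ M) u ≤ deg G u
  deg-∖≤ u = count-mono (adj? (G ∖ M) u) (adj? G u) (λ _ → proj₁)

  deg-∖≥ : ∀ u → deg G u ≤ suc (deg (G ∖ M) u)
  deg-∖≥ u with partner M u ≟ u
  ... | yes e = ℕ.m≤n⇒m≤1+n (ℕ.≤-reflexive (sym (deg-unmatched e)))
  ... | no ne = ℕ.≤-reflexive (deg-matched ne)

record Peeling {n} (G : DecGraph n) (k : ℕ) : Set where
  field
    matching : Matching G
    saturated : ∀ {u} → partner matching u ≢ u → deg G u ≡ k
    colouring : Colouring k (λ _ → Adj (G ∖ matching))
    total     : Total (G ∖ matching) colouring

-- Maximality of the matching makes the vertices which keep degree k independent.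
opaque
  peel : ∀ {n} (G : DecGraph n) k → (∀ u → deg G u ≤ k) → Peeling G k
  peel {n} G k deg≤k = record
    { matching  = M
    ; saturated = λ ne → proj₁ (proj₂ (sound C ne))
    ; colouring = proj₁ coloured
    ; total     = proj₂ coloured
    }
    where
    E : Fin 1 → Fin n → Fin n → Set
    E _ u v = Adj G u v × deg G u ≡ k × deg G v ≡ k
    -- A maximal colouring with a single colour is a maximal matching.
    max : Σ[ C ∈ Colouring 1 E ] (∀ c u v → E c u v → Covered C u v ⊎ ¬ Missing C c u ⊎ ¬ Missing C c v)
    max = maximalColouring {E = E} (λ _ u v → adj? G u v ×-dec deg G u ℕ.≟ k ×-dec deg G v ℕ.≟ k)
      (λ (a , p , q) → symm G a , q , p)
    C : Colouring 1 E
    C = proj₁ max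
    M : Matching G
    M = record
      { partner = mate C zero ; partner² = involutive C zero ; isEdge = λ ne → proj₁ (sound C ne) }
    unmatched : ∀ {u} → deg (G ∖ M) u ≡ k → partner M u ≡ u
    unmatched {u} e with partner M u ≟ u
    ... | yes m = m
    ... | no ne = contradiction (subst (_≤ k) (trans (deg-matched G M ne) (cong suc e)) (deg≤k u)) (ℕ.<-irrefl refl)
    independent : ∀ {u v} → Adj (G ∖ M) u v → deg (G ∖ M) u ≡ k → deg (G ∖ M) v < k
    independent {u} {v} (a , ne) du = ℕ.≤∧≢⇒< (ℕ.≤-trans (deg-∖≤ G M v) (deg≤k v)) clash
      where
      clash : deg (G ∖ M) v ≢ k
      clash dv with proj₂ max zero u v (a , trans (sym (deg-unmatched G M (unmatched du))) du
                                          , trans (sym (deg-unmatched G M (unmatched dv))) dv)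
      ... | inj₁ (zero , e) = ne e
      ... | inj₂ (inj₁ m)   = m (unmatched du)
      ... | inj₂ (inj₂ m)   = m (unmatched dv)
    coloured : Σ[ D ∈ Colouring k (λ _ → Adj (G ∖ M)) ] Total (G ∖ M) D
    coloured = fournier (G ∖ M) (λ u → ℕ.≤-trans (deg-∖≤ G M u) (deg≤k u)) independent

-- The matching `hook` contains every leftover edge with an end that is not heavy. Through `light`
-- such an end has only this leftover edge, and the opposite end has the full degree `suc K`, which
-- leaves no edge there to the other party.
record Decomposition {n} (G : DecGraph n) (K : ℕ) : Set₁ where
  field
    rest      : DecGraph n
    rest⊆     : ∀ {u v} → Adj rest u v → Adj G u v
    colouring : Colouring K (λ _ → Adj rest)
    total     : Total rest colouring
    hook      : Fin n → Fin n
    hook²     : ∀ u → hook (hook u) ≡ u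

  -- A heavy vertex with a leftover edge has degree at least K in G, so the other party
  -- has at most one edge there.
  Heavy : Fin n → Set
  Heavy v = K ≤ suc (deg rest v)

  heavy? : Decidable Heavy
  heavy? v = K ℕ.≤? suc (deg rest v)

  Leftover : Fin n → Fin n → Set
  Leftover u v = Adj G u v × ¬ Adj rest u v

  field
    light : ∀ {x y} → Leftover x y → ¬ Heavy x → hook x ≡ y × deg G y ≡ suc K × Heavy y

  leftover? : ∀ u v → Dec (Leftover u v)
  leftover? u v = adj? G u v ×-dec ¬? (adj? rest u v)

  leftover-sym : ∀ {u v} → Leftover u v → Leftover v u
  leftover-sym (a , ¬r) = symm G a , λ r → ¬r (symm rest r)

-- Peel off a matching M, colour the rest with suc K colours, remove the matching N of the
-- edges of the first colour which meet a vertex of degree suc K, and peel off a second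
-- matching L; this leaves a graph with a colouring by K colours. Only edges of N
-- can have an end which is not heavy.
opaque
  decompose : ∀ {n} (G : DecGraph n) K → (∀ u → deg G u ≤ suc K) → Decomposition G K
  decompose {n} G K deg≤ = record
    { rest      = G₃
    ; rest⊆     = λ a → proj₁ (proj₁ (proj₁ a))
    ; colouring = Peeling.colouring second
    ; total     = Peeling.total second
    ; hook      = hook
    ; hook²     = hook²
    ; light     = light
    }
    where
    first : Peeling G (suc K)
    first = peel G (suc K) deg≤
    M : Matching G
    M = Peeling.matching first
    G₁ : DecGraph n
    G₁ = G ∖ M
    C : Colouring (suc K) (λ _ → Adj G₁)
    C = Peeling.colouring first
    Full : Fin n → Set
    Full u = deg G₁ u ≡ suc K
    full? : Decidable Full
    full? u = deg G₁ u ℕ.≟ suc K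
    toFull? : ∀ u → Dec (Full u ⊎ Full (mate C zero u))
    toFull? u = full? u ⊎-dec full? (mate C zero u)
    hook : Fin n → Fin n
    hook u = if does (toFull? u) then mate C zero u else u
    hook-yes : ∀ {u} → Full u ⊎ Full (mate C zero u) → hook u ≡ mate C zero u
    hook-yes {u} f = if-yes (toFull? u) f
    hook-no : ∀ {u} → ¬ (Full u ⊎ Full (mate C zero u)) → hook u ≡ u
    hook-no {u} ¬f = if-no (toFull? u) ¬f
    hook² : ∀ u → hook (hook u) ≡ u
    hook² u = go (toFull? u)
      where
      back : Full u ⊎ Full (mate C zero u) →
             Full (mate C zero u) ⊎ Full (mate C zero (mate C zero u))
      back (inj₁ f) = inj₂ (subst Full (sym (involutive C zero u)) f)
      back (inj₂ f) = inj₁ f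
      go : Dec (Full u ⊎ Full (mate C zero u)) → hook (hook u) ≡ u
      go (yes f) = trans (cong hook (hook-yes f)) (trans (hook-yes (back f)) (involutive C zero u))
      go (no ¬f) = trans (cong hook (hook-no ¬f)) (hook-no ¬f)
    hooked : ∀ {u} → hook u ≢ u → Full u ⊎ Full (mate C zero u)
    hooked {u} ne = decidable-stable (toFull? u) (λ ¬f → ne (hook-no ¬f))
    N : Matching G₁
    N = record
      { partner  = hook
      ; partner² = hook²
      ; isEdge   = λ {u} ne → subst (Adj G₁ u) (sym (hook-yes (hooked ne)))
          (sound C (λ e → ne (trans (hook-yes (hooked ne)) e)))
      }
    G₂ : DecGraph n
    G₂ = G₁ ∖ N

    -- A full vertex has `suc K` edges in `suc K` colours, so it meets every colour. Without an edge
    -- of colour `zero`, its edges would inject into the remaining `K` colours.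
    full⇒hooked : ∀ {u} → Full u → hook u ≢ u
    full⇒hooked {u} f e = ℕ.<-irrefl refl (ℕ.≤-trans (ℕ.≤-reflexive (sym f)) few)
      where
      few : deg G₁ u ≤ K
      few = ℕ.≤-trans
        (count-inj (adj? G₁ u) (everything? ∖? zero) (λ v a → proj₁ (Peeling.total first a))
          (λ v a → tt , λ c≡0 → adj⇒≢ G₁ a (trans (sym (trans (sym (hook-yes (inj₁ f))) e))
            (subst (λ c → mate C c u ≡ v) c≡0 (proj₂ (Peeling.total first a)))))
          (λ v w a b c≡d → trans (sym (proj₂ (Peeling.total first a)))
            (trans (cong (λ c → mate C c u) c≡d) (proj₂ (Peeling.total first b)))))
        (ℕ.≤-reflexive (ℕ.suc-injective
          (trans (sym (count-remove (everything? {suc K}) {zero} tt)) (count-everything (suc K)))))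

    deg₂≤ : ∀ u → deg G₂ u ≤ K
    deg₂≤ u with full? u
    ... | yes f = ℕ.≤-reflexive (ℕ.suc-injective (trans (sym (deg-matched G₁ N (full⇒hooked f))) f))
    ... | no ¬f = ℕ.≤-trans (deg-∖≤ G₁ N u)
      (s≤s⁻¹ (ℕ.≤∧≢⇒< (ℕ.≤-trans (deg-∖≤ G M u) (deg≤ u)) ¬f))

    second : Peeling G₂ K
    second = peel G₂ K deg₂≤
    L : Matching G₂
    L = Peeling.matching second
    G₃ : DecGraph n
    G₃ = G₂ ∖ L
    Heavy : Fin n → Set
    Heavy v = K ≤ suc (deg G₃ v)

    heavy-L : ∀ {x} → partner L x ≢ x → Heavy x
    heavy-L ne = ℕ.≤-reflexive (trans (sym (Peeling.saturated second ne)) (deg-matched G₂ L ne))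
    heavy-full : ∀ {x} → Full x → Heavy x
    heavy-full {x} f = ℕ.≤-trans
      (s≤s⁻¹ (ℕ.≤-trans (ℕ.≤-reflexive (sym f)) (deg-∖≥ G₁ N x))) (deg-∖≥ G₂ L x)
    -- Removing `M` takes such a vertex from degree `suc K` to `K`. Unless `L` also meets it, which
    -- is settled by `heavy-L`, only `N` can take one more edge.
    heavy-M : ∀ {x} → partner M x ≢ x → Heavy x
    heavy-M {x} ne with partner L x ≟ x
    ... | no ne′ = heavy-L ne′
    ... | yes e  = ℕ.≤-trans
      (ℕ.≤-reflexive (ℕ.suc-injective (trans (sym (Peeling.saturated first ne)) (deg-matched G M ne))))
      (ℕ.≤-trans (deg-∖≥ G₁ N x) (s≤s (ℕ.≤-reflexive (sym (deg-unmatched G₂ L e)))))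

    light : ∀ {x y} → Adj G x y × ¬ Adj G₃ x y → ¬ Heavy x → hook x ≡ y × deg G y ≡ suc K × Heavy y
    light {x} {y} (a , ¬a₃) ¬h = hx≡y , full⇒ fully , heavy-full fully
      where
      x≢y : x ≢ y
      x≢y = adj⇒≢ G a
      unmatched : ∀ {z} → ¬ z ≢ x → z ≢ y
      unmatched {z} f e with z ≟ x
      ... | yes refl = x≢y e
      ... | no ne    = f ne
      -- As `x` is not heavy, neither `M` nor `L` meets it, so an edge at `x` that is not in `N`
      -- would survive all three removals.
      hx≡y : hook x ≡ y
      hx≡y = decidable-stable (hook x ≟ y) λ ne →
        ¬a₃ (((a , unmatched (¬h ∘ heavy-M)) , ne) , unmatched (¬h ∘ heavy-L))
      hx≢x : hook x ≢ x
      hx≢x e = x≢y (trans (sym e) hx≡y)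
      fully : Full y
      fully with hooked hx≢x
      ... | inj₁ f = contradiction (heavy-full f) ¬h
      ... | inj₂ f = subst Full (trans (sym (hook-yes (inj₂ f))) hx≡y) f
      full⇒ : Full y → deg G y ≡ suc K
      full⇒ f = ℕ.≤-antisym (deg≤ y) (ℕ.≤-trans (ℕ.≤-reflexive (sym f)) (deg-∖≤ G M y))


-- Ordering a palette

-- Double counting of the pairs of an element of `X` and a colour free there: if every colour were
-- free at fewer than half of `X`, then `(2 + K) * count X?` would be at most `(1 + K) * count X?`.
-- This forces `X` to be empty, and then the strict inequality fails already for the colour `zero`.
popularColour : ∀ {K n} {Free : Fin (suc K) → Fin n → Set} (Free? : ∀ c x → Dec (Free c x))
  {X : Fin n → Set} (X? : Decidable X) →
  (∀ {x} → X x → suc K < 2 * count (λ c → Free? c x)) →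
  ∃[ p ] count X? ≤ 2 * count (λ x → X? x ×-dec Free? p x)
popularColour {K} {n} {Free} Free? {X} X? rich
  with any? (λ p → count X? ℕ.≤? 2 * count (λ x → X? x ×-dec Free? p x))
... | yes found = found
... | no none   = contradiction (rare zero) λ lt → ℕ.n≮0 (ℕ.≤-trans lt no-X)
  where
  at : Fin (suc K) → Fin n → ℕ
  at p x = indicator (X? x ×-dec Free? p x)
  rare : ∀ p → 2 * sum (at p) < count X?
  rare p = ℕ.≰⇒> λ le → none (p , le)
  local : ∀ x → (2 + K) * indicator (X? x) ≤ 2 * sum (λ p → at p x)
  local x with X? x
  ... | no _  = ℕ.≤-trans (ℕ.≤-reflexive (ℕ.*-zeroʳ K)) z≤n
  ... | yes q = ℕ.≤-trans (ℕ.≤-reflexive (ℕ.*-identityʳ (2 + K)))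
    (ℕ.≤-trans (rich q) (ℕ.*-monoʳ-≤ 2 (count-mono (λ p → Free? p x) (λ p → yes q ×-dec Free? p x) (λ p f → q , f))))
  counted : (2 + K) * count X? ≤ (1 + K) * count X?
  counted = begin
    (2 + K) * count X?                         ≡⟨ *-distribˡ-sum (2 + K) (λ x → indicator (X? x)) ⟩
    sum (λ x → (2 + K) * indicator (X? x))     ≤⟨ sum-mono local ⟩
    sum (λ x → 2 * sum (λ p → at p x))         ≡⟨ sym (*-distribˡ-sum 2 (λ x → sum (λ p → at p x))) ⟩
    2 * sum (λ x → sum (λ p → at p x))         ≡⟨ cong (2 *_) (∑-comm (λ x p → at p x)) ⟩
    2 * sum (λ p → sum (at p))                 ≡⟨ *-distribˡ-sum 2 (λ p → sum (at p)) ⟩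
    sum (λ p → 2 * sum (at p))                 ≤⟨ sum≤n*m (λ p → ℕ.<⇒≤ (rare p)) ⟩
    (1 + K) * count X?                         ∎
    where open ℕ.≤-Reasoning
  no-X : count X? ≤ 0
  no-X = ℕ.+-cancelʳ-≤ ((1 + K) * count X?) (count X?) 0 counted

-- If every x ∈ X has more than half of the colours free, then the colours can be
-- ordered so that the first free colours are early on average: repeatedly take a
-- colour free at half of the remaining elements of X.
record Offers {K n : ℕ} (Free : Fin K → Fin n → Set) {X : Fin n → Set} (X? : Decidable X) : Set where
  field
    order   : Permutation K K
    offer   : Fin n → ℕ
    offered : ∀ {x} → X x → ∃[ c ] offer x ≡ suc (toℕ c) × Free (order ⟨$⟩ʳ c) x
    silent  : ∀ {x} → ¬ X x → offer x ≡ 0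
    cheap   : sum offer ≤ 2 * count X?

-- The popular colour `p` comes first. The elements of `X` not served by it number at most half, and
-- they stay rich in the smaller palette because the colour taken away was not free there. The cost
-- is one per element of `X` plus, inductively, twice the number of those left, so at most
-- `2 * count X?`.
offers : ∀ {K n} {Free : Fin K → Fin n → Set} (Free? : ∀ c x → Dec (Free c x))
  {X : Fin n → Set} (X? : Decidable X) →
  (∀ {x} → X x → K < 2 * count (λ c → Free? c x)) → Offers Free X?
offers {zero} {n} Free? X? rich = record
  { order   = Perm.id
  ; offer   = λ _ → 0
  ; offered = λ p → contradiction (rich p) λ ()
  ; silent  = λ _ → refl
  ; cheap   = ℕ.≤-trans (sum≤n*m {n} {0} (λ _ → z≤n)) (ℕ.≤-trans (ℕ.≤-reflexive (ℕ.*-zeroʳ n)) z≤n)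
  }
offers {suc K} {n} {Free} Free? {X} X? rich = record
  { order   = Perm.lift₀ order ∘ₚ τ
  ; offer   = offer⁺
  ; offered = λ {x} q → offered⁺ x q (Free? p x)
  ; silent  = λ {x} ¬q → if-no (X? x) ¬q
  ; cheap   = cheap⁺
  }
  where
  popular = popularColour Free? X? rich
  p : Fin (suc K)
  p = proj₁ popular
  τ : Permutation (suc K) (suc K)
  τ = Perm.transpose zero p
  X′ : Fin n → Set
  X′ x = X x × ¬ Free p x
  X′? : Decidable X′
  X′? x = X? x ×-dec ¬? (Free? p x)
  Free′ : Fin K → Fin n → Set
  Free′ c x = Free (τ ⟨$⟩ʳ suc c) x
  Free′? : ∀ c x → Dec (Free′ c x)
  Free′? c x = Free? (τ ⟨$⟩ʳ suc c) x
  rich′ : ∀ {x} → X′ x → K < 2 * count (λ c → Free′? c x)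
  rich′ {x} (q , ¬f) = ℕ.<-trans (ℕ.n<1+n K)
    (subst (λ m → suc K < 2 * m)
      (trans (sum-permute (λ c → indicator (Free? c x)) τ)
             (cong (_+ count (λ c → Free′? c x)) (indicator-no (Free? p x) ¬f)))
      (rich q))
  open Offers (offers Free′? X′? rich′)
  offer⁺ : Fin n → ℕ
  offer⁺ x = if does (X? x) then (if does (Free? p x) then 1 else suc (offer x)) else 0
  offered⁺ : ∀ x → X x → Dec (Free p x) →
             ∃[ c ] offer⁺ x ≡ suc (toℕ c) × Free ((Perm.lift₀ order ∘ₚ τ) ⟨$⟩ʳ c) x
  offered⁺ x q (yes f) = zero , trans (if-yes (X? x) q) (if-yes (Free? p x) f) , f
  offered⁺ x q (no ¬f) with offered (q , ¬f)
  ... | c , e , f = suc c , trans (if-yes (X? x) q) (trans (if-no (Free? p x) ¬f) (cong suc e)) , f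
  bound : ∀ x → offer⁺ x ≤ indicator (X? x) + offer x
  bound x with X? x | Free? p x
  ... | no _  | _     = z≤n
  ... | yes _ | yes _ = s≤s z≤n
  ... | yes _ | no _  = ℕ.≤-refl
  halved : 2 * count X′? ≤ count X?
  halved = ℕ.+-cancelˡ-≤ (count X?) (2 * count X′?) (count X?) (begin
    count X? + 2 * count X′?         ≤⟨ ℕ.+-monoˡ-≤ (2 * count X′?) (proj₂ popular) ⟩
    2 * count X∧F? + 2 * count X′?   ≡⟨ sym (ℕ.*-distribˡ-+ 2 (count X∧F?) (count X′?)) ⟩
    2 * (count X∧F? + count X′?)     ≡⟨ cong (2 *_) (count-split X? (Free? p)) ⟩
    2 * count X?                     ≡⟨ cong (count X? +_) (ℕ.+-identityʳ (count X?)) ⟩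
    count X? + count X?              ∎)
    where
    open ℕ.≤-Reasoning
    X∧F? : Decidable (λ x → X x × Free p x)
    X∧F? x = X? x ×-dec Free? p x
  cheap⁺ : sum offer⁺ ≤ 2 * count X?
  cheap⁺ = begin
    sum offer⁺                                     ≤⟨ sum-mono bound ⟩
    sum (λ x → indicator (X? x) + offer x)         ≡⟨ ∑-distrib-+ (λ x → indicator (X? x)) offer ⟩
    count X? + sum offer                           ≤⟨ ℕ.+-monoʳ-≤ (count X?) (ℕ.≤-trans cheap halved) ⟩
    count X? + count X?                            ≡⟨ cong (count X? +_) (sym (ℕ.+-identityʳ (count X?))) ⟩
    2 * count X?                                   ∎
    where open ℕ.≤-Reasoning

-- Greedy colouring with forbidden colours at vertices.

module _ {n : ℕ} (k : ℕ) (G : DecGraph n) {Forbidden : Fin k → Fin n → Set}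
         (forbidden? : ∀ c v → Dec (Forbidden c v)) where

  Allowed : Fin k → Fin n → Fin n → Set
  Allowed c u v = Adj G u v × ¬ Forbidden c u × ¬ Forbidden c v

  load : Fin n → ℕ
  load v = count (λ c → forbidden? c v) + deg G v

  opaque
    -- At an uncovered edge of a maximal colouring, each of the `k` colours is forbidden or used at
    -- one of the ends. The edge itself carries no colour, so each end blocks at most its load minus
    -- one, whence `k + 2` is at most the sum of the loads.
    greedy : Σ[ C ∈ Colouring k Allowed ]
             (∀ {u v} → Adj G u v → load u + load v ≤ suc k → Covered C u v)
    greedy = C , λ {u} {v} → cover u v
      where
      max : Σ[ C ∈ Colouring k Allowed ]
            (∀ c u v → Allowed c u v → Covered C u v ⊎ ¬ Missing C c u ⊎ ¬ Missing C c v)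
      max = maximalColouring
        (λ c u v → adj? G u v ×-dec ¬? (forbidden? c u) ×-dec ¬? (forbidden? c v))
        (λ (a , p , q) → symm G a , q , p)
      C : Colouring k Allowed
      C = proj₁ max
      cover : ∀ u v → Adj G u v → load u + load v ≤ suc k → Covered C u v
      cover u v a le with covered? C u v
      ... | yes cov = cov
      ... | no ¬cov = contradiction le (ℕ.<⇒≱ (begin-strict
        suc k                           ≡⟨ cong suc (sym (count-everything k)) ⟩
        suc (count (everything? {k}))         ≤⟨ s≤s (count-cover (blocked? u) (blocked? v) everything? (λ c _ → blockedAt c)) ⟩
        suc (count (blocked? u) + count (blocked? v))  ≤⟨ s≤s (ℕ.+-mono-≤ (blocked≤ u) (blocked≤ v)) ⟩
        suc (F u + U u + (F v + U v))   <⟨ ℕ.≤-reflexive shift ⟩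
        F u + suc (U u) + (F v + suc (U v))  ≤⟨ ℕ.+-mono-≤ (ℕ.+-monoʳ-≤ (F u) (used<deg G proj₁ C a ¬cov))
                                                  (ℕ.+-monoʳ-≤ (F v) (used<deg G proj₁ C (symm G a) (¬cov ∘ covered-sym C))) ⟩
        load u + load v                 ∎))
        where
        open ℕ.≤-Reasoning
        F U : Fin n → ℕ
        F w = count (λ c → forbidden? c w)
        U w = count (used? C w)
        shift : 2 + (F u + U u + (F v + U v)) ≡ F u + suc (U u) + (F v + suc (U v))
        shift = sym (trans (cong₂ _+_ (ℕ.+-suc (F u) (U u)) (ℕ.+-suc (F v) (U v)))
                           (cong suc (ℕ.+-suc (F u + U u) (F v + U v))))
        blocked? : ∀ w → Decidable (λ c → Forbidden c w ⊎ ¬ Missing C c w)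
        blocked? w c = forbidden? c w ⊎-dec used? C w c
        blocked≤ : ∀ w → count (blocked? w) ≤ F w + U w
        blocked≤ w = count-cover (λ c → forbidden? c w) (used? C w) (blocked? w) (λ _ → id)
        blockedAt : ∀ c → (Forbidden c u ⊎ ¬ Missing C c u) ⊎ (Forbidden c v ⊎ ¬ Missing C c v)
        blockedAt c with forbidden? c u | forbidden? c v
        ... | yes f | _     = inj₁ (inj₁ f)
        ... | no _  | yes f = inj₂ (inj₁ f)
        ... | no p  | no q with proj₂ max c u v (a , p , q)
        ...   | inj₁ cov      = contradiction cov ¬cov
        ...   | inj₂ (inj₁ m) = inj₁ (inj₂ m)
        ...   | inj₂ (inj₂ m) = inj₂ (inj₂ m)

-- Coding tables of numbers as messages.

unary : ℕ → Message → Message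
unary zero    ms = false ∷ ms
unary (suc k) ms = true ∷ unary k ms

readUnary : Message → ℕ × Message
readUnary []           = 0 , []
readUnary (false ∷ ms) = 0 , ms
readUnary (true ∷ ms)  = let k , rest = readUnary ms in suc k , rest

readUnary-unary : ∀ k ms → readUnary (unary k ms) ≡ (k , ms)
readUnary-unary zero    ms = refl
readUnary-unary (suc k) ms rewrite readUnary-unary k ms = refl

length-unary : ∀ k ms → length (unary k ms) ≡ suc k + length ms
length-unary zero    ms = refl
length-unary (suc k) ms = cong suc (length-unary k ms)

encodeRow : ∀ {n} → (Fin n → ℕ) → Message → Message
encodeRow {zero}  f ms = ms
encodeRow {suc n} f ms = unary (f zero) (encodeRow (f ∘ suc) ms)

decodeRow : ∀ n → Message → (Fin n → ℕ) × Message
decodeRow zero    ms = (λ ()) , ms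
decodeRow (suc n) ms =
  let k , ms′ = readUnary ms ; f , rest = decodeRow n ms′
  in (λ { zero → k ; (suc i) → f i }) , rest

decode-encodeRow : ∀ {n} (f : Fin n → ℕ) ms →
  (∀ i → proj₁ (decodeRow n (encodeRow f ms)) i ≡ f i) × proj₂ (decodeRow n (encodeRow f ms)) ≡ ms
decode-encodeRow {zero}  f ms = (λ ()) , refl
decode-encodeRow {suc n} f ms =
  (λ { zero    → cong proj₁ first
     ; (suc i) → trans (cong (λ m → proj₁ (decodeRow n (proj₂ m)) i) first) (proj₁ others i) }) ,
  trans (cong (λ m → proj₂ (decodeRow n (proj₂ m))) first) (proj₂ others)
  where
  first = readUnary-unary (f zero) (encodeRow (f ∘ suc) ms)
  others = decode-encodeRow (f ∘ suc) ms

length-encodeRow : ∀ {n} (f : Fin n → ℕ) ms → length (encodeRow f ms) ≡ sum f + n + length ms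
length-encodeRow {zero}  f ms = refl
length-encodeRow {suc n} f ms = begin
  length (unary (f zero) (encodeRow (f ∘ suc) ms))  ≡⟨ length-unary (f zero) _ ⟩
  suc (f zero) + length (encodeRow (f ∘ suc) ms)    ≡⟨ cong (suc (f zero) +_) (length-encodeRow (f ∘ suc) ms) ⟩
  suc (f zero) + (sum (f ∘ suc) + n + length ms)    ≡⟨ sym (ℕ.+-assoc (suc (f zero)) (sum (f ∘ suc) + n) (length ms)) ⟩
  suc (f zero) + (sum (f ∘ suc) + n) + length ms    ≡⟨ cong (λ m → suc m + length ms) (sym (ℕ.+-assoc (f zero) (sum (f ∘ suc)) n)) ⟩
  suc (f zero + sum (f ∘ suc) + n) + length ms      ≡⟨ cong (_+ length ms) (sym (ℕ.+-suc (f zero + sum (f ∘ suc)) n)) ⟩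
  f zero + sum (f ∘ suc) + suc n + length ms        ∎
  where open ≡-Reasoning

encode : ∀ {r n} → (Fin r → Fin n → ℕ) → Message
encode {zero}  f = []
encode {suc r} f = encodeRow (f zero) (encode (f ∘ suc))

decode : ∀ r n → Message → Fin r → Fin n → ℕ
decode (suc r) n ms zero    = proj₁ (decodeRow n ms)
decode (suc r) n ms (suc i) = decode r n (proj₂ (decodeRow n ms)) i

decode-encode : ∀ {r n} (f : Fin r → Fin n → ℕ) i j → decode r n (encode f) i j ≡ f i j
decode-encode {suc r}     f zero    j = proj₁ (decode-encodeRow (f zero) (encode (f ∘ suc))) j
decode-encode {suc r} {n} f (suc i) j = trans
  (cong (λ ms → decode r n ms i j) (proj₂ (decode-encodeRow (f zero) (encode (f ∘ suc)))))
  (decode-encode (f ∘ suc) i j)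

-- The summand `n` in each row pays for the closing `false` of each unary number, which makes the
-- numbers self-delimiting.
length-encode : ∀ {r n} (f : Fin r → Fin n → ℕ) → length (encode f) ≡ sum (λ i → sum (f i) + n)
length-encode {zero}  f = refl
length-encode {suc r} {n} f = trans (length-encodeRow (f zero) _) (cong (sum (f zero) + n +_) (length-encode (f ∘ suc)))

-- What a party computes from its own graph.

permuteColours : ∀ {n k} {E : Fin n → Fin n → Set} → Permutation k k →
                 Colouring k (λ _ → E) → Colouring k (λ _ → E)
permuteColours π C = record
  { mate       = λ c → mate C (π ⟨$⟩ʳ c)
  ; involutive = λ c → involutive C (π ⟨$⟩ʳ c)
  ; disjoint   = λ {c} {d} e ne → trans (sym (Perm.inverseˡ π))
      (trans (cong (π ⟨$⟩ˡ_) (disjoint C e ne)) (Perm.inverseˡ π))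
  ; sound      = sound C
  }

record Plan {n} (G : DecGraph n) (K : ℕ) : Set₁ where
  field
    decomposition : Decomposition G K
  open Decomposition decomposition public hiding (colouring; total)
  field
    colouring : Colouring K (λ _ → Adj rest)
    total     : Total rest colouring
    offer     : Fin n → ℕ
    offered   : ∀ {x j} → offer x ≡ suc j → ∃[ c ] toℕ c ≡ j × Missing colouring c x
    silent    : ∀ {x} → offer x ≡ 0 → K ≤ 2 * deg rest x
    cheap     : sum offer ≤ 2 * n

  missing-isolated : ∀ {c x} → deg G x ≡ 0 → Missing colouring c x
  missing-isolated {c} {x} e with mate colouring c x ≟ x
  ... | yes m = m
  ... | no ne = contradiction (rest⊆ (sound colouring ne)) (count-none (adj? G x) e _)

plan : ∀ {n} (G : DecGraph n) K → (∀ u → deg G u ≤ suc K) → Plan G K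
plan {n} G K deg≤ = record
  { decomposition = D
  -- Renaming the palette along `order` makes the position of a colour its name, so an offer is
  -- understood by the other party without knowledge of the order.
  ; colouring     = permuteColours order C
  ; total         = λ a → let c , e = total a in
      order ⟨$⟩ˡ c , trans (cong (λ d → mate C d _) (Perm.inverseʳ order)) e
  ; offer         = offer
  ; offered       = λ {x} → offered′ x (rich? x)
  ; silent        = silent′
  ; cheap         = ℕ.≤-trans cheap (ℕ.*-monoʳ-≤ 2 (sum-indicator≤ rich?))
  }
  where
  D : Decomposition G K
  D = decompose G K deg≤
  open Decomposition D using (rest; total) renaming (colouring to C)
  Rich : Fin n → Set
  Rich x = K < 2 * count (λ c → mate C c x ≟ x)
  rich? : Decidable Rich
  rich? x = K ℕ.<? 2 * count (λ c → mate C c x ≟ x)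
  open Offers (offers {Free = λ c x → Missing C c x} (λ c x → mate C c x ≟ x) rich? id)
  offered′ : ∀ x {j} → Dec (Rich x) → offer x ≡ suc j →
             ∃[ c ] toℕ c ≡ j × Missing C (order ⟨$⟩ʳ c) x
  offered′ x (no ¬r) e = contradiction (trans (sym e) (silent ¬r)) λ ()
  offered′ x (yes r) e with offered r
  ... | c , e′ , m = c , ℕ.suc-injective (trans (sym e′) e) , m
  silent′ : ∀ {x} → offer x ≡ 0 → K ≤ 2 * deg rest x
  silent′ {x} e with rich? x
  ... | yes r = contradiction (trans (sym e) (proj₁ (proj₂ (offered r)))) λ ()
  -- At most half of the colours are free at `x`, so at least half are used there, each by a
  -- different edge of `rest`.
  ... | no ¬r = ℕ.+-cancelʳ-≤ K K (2 * deg rest x) (begin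
    K + K                                ≡⟨ cong (K +_) (sym (ℕ.+-identityʳ K)) ⟩
    2 * K                                ≡⟨ cong (2 *_) (sym (count-everything K)) ⟩
    2 * count (everything? {K})            ≤⟨ ℕ.*-monoʳ-≤ 2 (count-cover (used? C x) (λ c → mate C c x ≟ x) everything? split) ⟩
    2 * (count (used? C x) + F)          ≡⟨ ℕ.*-distribˡ-+ 2 (count (used? C x)) F ⟩
    2 * count (used? C x) + 2 * F        ≤⟨ ℕ.+-mono-≤ (ℕ.*-monoʳ-≤ 2 (used≤deg rest id C x)) (ℕ.≮⇒≥ ¬r) ⟩
    2 * deg rest x + K                   ∎)
    where
    open ℕ.≤-Reasoning
    F : ℕ
    F = count (λ c → mate C c x ≟ x)
    split : ∀ c → ⊤ → ¬ Missing C c x ⊎ Missing C c x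
    split c _ with mate C c x ≟ x
    ... | yes m = inj₂ m
    ... | no ¬m = inj₁ ¬m

-- The colours of a party's edges

data Hue : Set where
  own    : ℕ → Hue
  other  : ℕ → Hue
  shared : Hue

offerHue : ℕ → Hue
offerHue zero    = shared
offerHue (suc j) = other j

offerHue≢own : ∀ m {j} → offerHue m ≢ own j
offerHue≢own zero    ()
offerHue≢own (suc m) ()

offerHue-other : ∀ m {j} → offerHue m ≡ other j → m ≡ suc j
offerHue-other (suc m) refl = refl

offerHue-shared : ∀ m → offerHue m ≡ shared → m ≡ 0
offerHue-shared zero refl = refl

own-injective : ∀ {i j} → own i ≡ own j → i ≡ j
own-injective refl = refl

other-injective : ∀ {i j} → other i ≡ other j → i ≡ j
other-injective refl = refl

-- What a party tells the other: its offers, and at which vertices it uses each of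
-- its first three colours.
report : ∀ {n K} {G : DecGraph n} → Plan G (3 + K) → Fin 4 → Fin n → ℕ
report {K = K} P zero    v = Plan.offer P v
report {K = K} P (suc c) v = indicator (used? (Plan.colouring P) v (c ↑ˡ K))

module _ {n K : ℕ} {G : DecGraph n} (P : Plan G (3 + K)) (heard : Fin 4 → Fin n → ℕ) where

  open Plan P

  private
    Busy : Fin 3 → Fin n → Set
    Busy c v = heard (suc c) v ≢ 0

    Offered : Fin 3 → Fin n → Fin n → Set
    Offered c v x = (Leftover v x × ¬ Heavy x) × heard zero x ≡ suc (toℕ c)

    -- The second alternative concerns the party's own edges: the edge from `v` to an end `x` that
    -- is not heavy takes the colour offered at `x`, which the heavy edges at `v` must then avoid.
    Forbidden : Fin 3 → Fin n → Set
    Forbidden c v = Busy c v ⊎ ∃[ x ] Offered c v x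

    busy? : ∀ c v → Dec (Busy c v)
    busy? c v = ¬? (heard (suc c) v ℕ.≟ 0)

    toLight? : ∀ v x → Dec (Leftover v x × ¬ Heavy x)
    toLight? v x = leftover? v x ×-dec ¬? (heavy? x)

    offered? : ∀ c v → Dec (∃[ x ] Offered c v x)
    offered? c v = any? (λ x → toLight? v x ×-dec heard zero x ℕ.≟ suc (toℕ c))

    forbidden? : ∀ c v → Dec (Forbidden c v)
    forbidden? c v = busy? c v ⊎-dec offered? c v

    heavyGraph : DecGraph n
    heavyGraph = record
      { Adj    = λ u v → Leftover u v × Heavy u × Heavy v
      ; adj?   = λ u v → leftover? u v ×-dec heavy? u ×-dec heavy? v
      ; symm   = λ (l , p , q) → leftover-sym l , q , p
      ; irrefl = λ (l , _) → irrefl G (proj₁ l)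
      }

    τ : Colouring 3 (Allowed 3 heavyGraph forbidden?)
    τ = proj₁ (greedy 3 heavyGraph forbidden?)

  -- As a relation, this is symmetric by exchanging `lightˡ` and `lightʳ`, and its properties follow
  -- by cases without the decisions made in `hue`. An edge whose end is not heavy follows the offer
  -- heard for that end.
  data HueOf (u v : Fin n) : Hue → Set where
    normal : ∀ c → Adj rest u v → mate colouring c u ≡ v → HueOf u v (own (toℕ c))
    lightˡ : Leftover u v → ¬ Heavy u → HueOf u v (offerHue (heard zero u))
    lightʳ : Leftover u v → ¬ Heavy v → HueOf u v (offerHue (heard zero v))
    heavy  : ∀ c → Leftover u v → Heavy u → Heavy v → mate τ c u ≡ v → HueOf u v (other (toℕ c))

  HueOf-sym : ∀ {u v h} → HueOf u v h → HueOf v u h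
  HueOf-sym (normal c a e)    = normal c (symm rest a) (swap-mate colouring e)
  HueOf-sym (lightˡ l p)      = lightʳ (leftover-sym l) p
  HueOf-sym (lightʳ l p)      = lightˡ (leftover-sym l) p
  HueOf-sym (heavy c l p q e) = heavy c (leftover-sym l) q p (swap-mate τ e)

  HueOf-unique : ∀ {u v h h′} → HueOf u v h → HueOf u v h′ → h ≡ h′
  HueOf-unique (normal c a e) (normal d _ f) = cong (own ∘ toℕ)
    (disjoint colouring (trans e (sym f)) (λ m → adj⇒≢ rest a (trans (sym m) e)))
  HueOf-unique (heavy c l _ _ e) (heavy d _ _ _ f) = cong (other ∘ toℕ)
    (disjoint τ (trans e (sym f)) (λ m → adj⇒≢ G (proj₁ l) (trans (sym m) e)))
  HueOf-unique (lightˡ _ _) (lightˡ _ _) = refl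
  HueOf-unique (lightʳ _ _) (lightʳ _ _) = refl
  HueOf-unique (normal _ a _) (lightˡ l _)      = contradiction a (proj₂ l)
  HueOf-unique (normal _ a _) (lightʳ l _)      = contradiction a (proj₂ l)
  HueOf-unique (normal _ a _) (heavy _ l _ _ _) = contradiction a (proj₂ l)
  HueOf-unique (lightˡ l _) (normal _ a _)      = contradiction a (proj₂ l)
  HueOf-unique (lightʳ l _) (normal _ a _)      = contradiction a (proj₂ l)
  HueOf-unique (heavy _ l _ _ _) (normal _ a _) = contradiction a (proj₂ l)
  HueOf-unique (lightˡ l p) (lightʳ _ q)      = contradiction (proj₂ (proj₂ (light l p))) q
  HueOf-unique (lightʳ _ q) (lightˡ l p)      = contradiction (proj₂ (proj₂ (light l p))) q
  HueOf-unique (lightˡ _ p) (heavy _ _ q _ _) = contradiction q p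
  HueOf-unique (lightʳ _ p) (heavy _ _ _ q _) = contradiction q p
  HueOf-unique (heavy _ _ q _ _) (lightˡ _ p) = contradiction q p
  HueOf-unique (heavy _ _ _ q _) (lightʳ _ p) = contradiction q p

  private
    hook-≡ : ∀ {u v w} → Leftover u v → Leftover u w → ¬ Heavy u → v ≡ w
    hook-≡ l l′ p = trans (sym (proj₁ (light l p))) (proj₁ (light l′ p))

    -- The colour offered at `v` is forbidden at `u`, and `τ` places no forbidden colour.
    clash : ∀ {u v w} c → Leftover u v → ¬ Heavy v → heard zero v ≡ suc (toℕ c) →
            u ≢ w → mate τ c u ≢ w
    clash {u} {v} c l p e u≢w f = proj₁ (proj₂ (sound τ (λ m → u≢w (trans (sym m) f))))
      (inj₂ (v , (l , p) , e))

  HueOf-proper : ∀ {u v w h h′} → HueOf u v h → HueOf u w h′ → h ≡ h′ → v ≡ w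
  HueOf-proper (normal c _ e) (normal d _ f) q with toℕ-injective (own-injective q)
  ... | refl = trans (sym e) f
  HueOf-proper (heavy c _ _ _ e) (heavy d _ _ _ f) q with toℕ-injective (other-injective q)
  ... | refl = trans (sym e) f
  HueOf-proper (lightˡ l p) (lightˡ l′ _) _ = hook-≡ l l′ p
  HueOf-proper (lightˡ l p) (lightʳ l′ _) _ = hook-≡ l l′ p
  HueOf-proper (lightʳ l _) (lightˡ l′ p) _ = hook-≡ l l′ p
  HueOf-proper {u} {v} {w} (lightʳ l p) (lightʳ l′ p′) _ = trans (sym (hook² v))
    (trans (cong hook (trans (proj₁ (light (leftover-sym l) p)) (sym (proj₁ (light (leftover-sym l′) p′)))))
           (hook² w))
  HueOf-proper (normal _ _ _) (lightˡ _ _) q = contradiction (sym q) (offerHue≢own _)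
  HueOf-proper (normal _ _ _) (lightʳ _ _) q = contradiction (sym q) (offerHue≢own _)
  HueOf-proper (lightˡ _ _) (normal _ _ _) q = contradiction q (offerHue≢own _)
  HueOf-proper (lightʳ _ _) (normal _ _ _) q = contradiction q (offerHue≢own _)
  HueOf-proper (normal _ _ _) (heavy _ _ _ _ _) ()
  HueOf-proper (heavy _ _ _ _ _) (normal _ _ _) ()
  HueOf-proper (lightˡ _ p) (heavy _ _ q _ _) _ = contradiction q p
  HueOf-proper (heavy _ _ q _ _) (lightˡ _ p) _ = contradiction q p
  HueOf-proper (lightʳ l p) (heavy c l′ _ _ e) q =
    contradiction e (clash c l p (offerHue-other _ q) (adj⇒≢ G (proj₁ l′)))
  HueOf-proper (heavy c l′ _ _ e) (lightʳ l p) q =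
    contradiction e (clash c l p (offerHue-other _ (sym q)) (adj⇒≢ G (proj₁ l′)))

  private
    searchHue : ∀ {u v} → Adj G u v → (∃[ h ] HueOf u v h) ⊎ (Adj heavyGraph u v × ¬ Covered τ u v)
    searchHue {u} {v} a with adj? rest u v
    ... | yes r = let c , e = total r in inj₁ (_ , normal c r e)
    ... | no ¬r with heavy? u | heavy? v
    ...   | no p  | _     = inj₁ (_ , lightˡ (a , ¬r) p)
    ...   | yes _ | no q  = inj₁ (_ , lightʳ (a , ¬r) q)
    ...   | yes p | yes q with covered? τ u v
    ...     | yes (c , e) = inj₁ (_ , heavy c (a , ¬r) p q e)
    ...     | no ¬cov     = inj₂ (((a , ¬r) , p , q) , ¬cov)

  -- `shared` is a placeholder for pairs that are not edges and for a failed search; `hue-correct`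
  -- rules out both on edges when the degrees fit.
  hue : Fin n → Fin n → Hue
  hue u v with adj? G u v
  ... | no _  = shared
  ... | yes a = [ proj₁ , (λ _ → shared) ]′ (searchHue a)

  -- A heavy vertex loses at most two edges minus those of the other party, so at most
  -- two of the three colours are taken at it, counting its own leftover edges.
  module _ (fits : ∀ v → count (λ c → busy? c v) + deg G v ≤ 4 + K) where

    private
      load≤2 : ∀ {v} → Heavy v → load 3 heavyGraph forbidden? v ≤ 2
      load≤2 {v} hv = ℕ.+-cancelʳ-≤ (2 + K) (F + deg heavyGraph v) 2 (begin
        F + deg heavyGraph v + (2 + K)        ≤⟨ ℕ.+-mono-≤ (ℕ.+-monoˡ-≤ (deg heavyGraph v) F≤) (s≤s⁻¹ hv) ⟩
        B + O + deg heavyGraph v + deg rest v ≤⟨ ℕ.+-monoˡ-≤ (deg rest v)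
                                                   (ℕ.≤-trans (ℕ.≤-reflexive (ℕ.+-assoc B O _)) (ℕ.+-monoʳ-≤ B O+H≤)) ⟩
        B + R + deg rest v                    ≡⟨ ℕ.+-assoc B R (deg rest v) ⟩
        B + (R + deg rest v)                  ≤⟨ ℕ.+-monoʳ-≤ B R+rest≤ ⟩
        B + deg G v                           ≤⟨ fits v ⟩
        4 + K                                 ∎)
        where
        open ℕ.≤-Reasoning
        F B O R : ℕ
        F = count (λ c → forbidden? c v)
        B = count (λ c → busy? c v)
        O = count (toLight? v)
        R = count (leftover? v)
        F≤ : F ≤ B + O
        F≤ = ℕ.≤-trans (count-cover (λ c → busy? c v) (λ c → offered? c v) (λ c → forbidden? c v) (λ _ → id))
          (ℕ.+-monoʳ-≤ B (count-inj (λ c → offered? c v) (toLight? v) (λ _ → proj₁) (λ _ o → proj₁ (proj₂ o))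
            (λ c d o o′ e → toℕ-injective (ℕ.suc-injective
              (trans (sym (proj₂ (proj₂ o))) (trans (cong (heard zero) e) (proj₂ (proj₂ o′))))))))
        O+H≤ : O + deg heavyGraph v ≤ R
        O+H≤ = count-disjoint (toLight? v) (adj? heavyGraph v) (leftover? v)
          (λ _ → proj₁) (λ _ → proj₁) (λ _ a b → proj₂ a (proj₂ (proj₂ b)))
        R+rest≤ : R + deg rest v ≤ deg G v
        R+rest≤ = count-disjoint (leftover? v) (adj? rest v) (adj? G v)
          (λ _ → proj₁) (λ _ → rest⊆) (λ _ → proj₂)

    hue-correct : ∀ {u v} → Adj G u v → HueOf u v (hue u v)
    hue-correct {u} {v} a with adj? G u v
    ... | no ¬a = contradiction a ¬a
    ... | yes b with searchHue b
    ...   | inj₁ (h , p)     = p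
    ...   | inj₂ (t , ¬cov) = contradiction (proj₂ (greedy 3 heavyGraph forbidden?) t
              (ℕ.+-mono-≤ (load≤2 (proj₁ (proj₂ t))) (load≤2 (proj₂ (proj₂ t))))) ¬cov

  -- Each alternative restrains the other party at `u`: at a full end it has no edge, and at an end
  -- that is not heavy it made no offer. The strict inequality records the leftover edge itself.
  HueOf-shared : ∀ {u v h} → HueOf u v h → h ≡ shared →
                 deg G u ≡ 4 + K ⊎ (heard zero u ≡ 0 × deg rest u < deg G u)
  HueOf-shared (normal _ _ _) ()
  HueOf-shared (heavy _ _ _ _ _) ()
  HueOf-shared (lightʳ l p) e = inj₁ (proj₁ (proj₂ (light (leftover-sym l) p)))
  HueOf-shared {u} {v} (lightˡ l p) e = inj₂ (offerHue-shared _ e ,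
    ℕ.≤-trans (s≤s (count-mono (adj? rest u) (adj? G u ∖? v)
                (λ _ r → rest⊆ r , λ { refl → proj₂ l r })))
              (ℕ.≤-reflexive (sym (count-remove (adj? G u) (proj₁ l)))))

  HueOf-own : ∀ {u v h j} → HueOf u v h → h ≡ own j →
              ∃[ c ] toℕ c ≡ j × ¬ Missing colouring c u
  HueOf-own (normal c a e) q = c , own-injective q , λ m → adj⇒≢ rest a (trans (sym m) e)
  HueOf-own (lightˡ _ _) q = contradiction q (offerHue≢own _)
  HueOf-own (lightʳ _ _) q = contradiction q (offerHue≢own _)

  module _ {H : DecGraph n} (Q : Plan H (3 + K)) (truthful : ∀ i v → heard i v ≡ report Q i v)
           (degrees : ∀ v → deg G v + deg H v ≤ 4 + K) where

    private
      idle : ∀ {v} → deg G v ≡ 4 + K → deg H v ≡ 0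
      idle {v} e = ℕ.n≤0⇒n≡0 (ℕ.+-cancelˡ-≤ (4 + K) (deg H v) 0
        (ℕ.≤-trans (subst (λ d → d + deg H v ≤ 4 + K) e (degrees v)) (ℕ.≤-reflexive (sym (ℕ.+-identityʳ (4 + K))))))

    fits-truthful : ∀ v → count (λ c → busy? c v) + deg G v ≤ 4 + K
    fits-truthful v = ℕ.≤-trans (ℕ.+-monoˡ-≤ (deg G v) (ℕ.≤-trans
        (count-inj (λ c → busy? c v) (used? (Plan.colouring Q) v) (λ c _ → c ↑ˡ K)
          (λ c b m → b (trans (truthful (suc c) v) (indicator-no (used? (Plan.colouring Q) v (c ↑ˡ K)) (λ u → u m))))
          (λ c d _ _ e → ↑ˡ-injective K c d e))
        (ℕ.≤-trans (used≤deg (Plan.rest Q) id (Plan.colouring Q) v)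
                   (count-mono (adj? (Plan.rest Q) v) (adj? H v) (λ _ → Plan.rest⊆ Q)))))
      (ℕ.≤-trans (ℕ.≤-reflexive (ℕ.+-comm (deg H v) (deg G v))) (degrees v))

    -- A borrowed colour is free for its owner at both ends, for three different reasons: it was
    -- offered at `u`, or the owner has no edge at `u` because `u` has full degree here, or the bit
    -- reported for one of the three fixed colours says so.
    HueOf-other : ∀ {u v h j} → HueOf u v h → h ≡ other j →
                  ∃[ c ] toℕ c ≡ j × Missing (Plan.colouring Q) c u
    HueOf-other {u} (lightˡ _ _) q = Plan.offered Q (trans (sym (truthful zero u)) (offerHue-other _ q))
    HueOf-other {u} {v} (lightʳ l p) q with Plan.offered Q (trans (sym (truthful zero v)) (offerHue-other _ q))
    ... | c , e , _ = c , e , Plan.missing-isolated Q (idle (proj₁ (proj₂ (light (leftover-sym l) p))))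
    HueOf-other {u} {v} (heavy c l _ _ e) q = c ↑ˡ K , trans (toℕ-↑ˡ c K) (other-injective q) ,
      decidable-stable (mate (Plan.colouring Q) (c ↑ˡ K) u ≟ u) λ ne →
        proj₁ (proj₂ (sound τ (λ m → adj⇒≢ G (proj₁ l) (trans (sym m) e))))
          (inj₁ λ z → contradiction
            (trans (sym z) (trans (truthful (suc c) u) (indicator-yes (used? (Plan.colouring Q) u (c ↑ˡ K)) ne))) λ ())

-- Protocols

toDecGraph : ∀ {n} → Graph n → DecGraph n
toDecGraph G = record
  { Adj    = λ u v → v ∈ neighbours G u
  ; adj?   = λ u v → v ∈? neighbours G u
  ; symm   = Graph.~-sym G
  ; irrefl = Graph.~-irrefl G _
  }

count-∈ : ∀ {n} (p : Subset n) → count (_∈? p) ≡ ∣ p ∣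
count-∈ []            = refl
count-∈ (false ∷ p) = trans
  (count-cong (λ i → suc i ∈? (false ∷ p)) (_∈? p) (λ _ → drop-there) (λ _ → there)) (count-∈ p)
count-∈ (true ∷ p)  = cong suc (trans
  (count-cong (λ i → suc i ∈? (true ∷ p)) (_∈? p) (λ _ → drop-there) (λ _ → there)) (count-∈ p))

deg≤maxDegree : ∀ {n} (G : Graph n) u → deg (toDecGraph G) u ≤ maxDegree G
deg≤maxDegree {n} G u = ℕ.≤-trans (ℕ.≤-reflexive (count-∈ (neighbours G u)))
  (All.lookup (xs≤max 0 (map (degree G) (allFin n))) (∈-map⁺ (degree G) (∈-allFin u)))

module _ {n : ℕ} {G A B : Graph n} (partition : IsEdgePartition G A B) where

  private module E = IsEdgePartition partition

  deg-partition : ∀ u → deg (toDecGraph A) u + deg (toDecGraph B) u ≤ deg (toDecGraph G) u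
  deg-partition u = count-disjoint (_∈? neighbours A u) (_∈? neighbours B u) (_∈? neighbours G u)
    (λ v a → subst (v ∈_) (sym (E.union u)) (x∈p∪q⁺ (inj₁ a)))
    (λ v b → subst (v ∈_) (sym (E.union u)) (x∈p∪q⁺ (inj₂ b)))
    (λ v a b → E.disjoint u (v , x∈p∩q⁺ (a , b)))

  combine-proper : ∀ {k χA χB} → IsProperEdgeColouring A k χA → IsProperEdgeColouring B k χB →
    (∀ {u v w} → v ∈ neighbours A u → w ∈ neighbours B u → χA u v ≢ χB u w) →
    IsProperEdgeColouring G k (combine A χA χB)
  combine-proper {k} {χA} {χB} okA okB cross = record
    { undirected = undirected ; in-palette = in-palette ; proper = proper }
    where
    module A = IsProperEdgeColouring okA
    module B = IsProperEdgeColouring okB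
    χ : EdgeColours n
    χ = combine A χA χB
    data Owner (u v : Fin n) : Set where
      alice : v ∈ neighbours A u → χ u v ≡ χA u v → Owner u v
      bob   : v ∈ neighbours B u → ¬ v ∈ neighbours A u → χ u v ≡ χB u v → Owner u v
    owner : ∀ {u v} → v ∈ neighbours G u → Owner u v
    owner {u} {v} g = go (v ∈? neighbours A u)
      where
      go : Dec (v ∈ neighbours A u) → Owner u v
      go (yes a) = alice a (if-yes (v ∈? neighbours A u) a)
      go (no ¬a) = bob ([ (λ a → contradiction a ¬a) , id ]′
        (x∈p∪q⁻ (neighbours A u) (neighbours B u) (subst (v ∈_) (E.union u) g))) ¬a
        (if-no (v ∈? neighbours A u) ¬a)
    undirected : ∀ {u v} → v ∈ neighbours G u → χ u v ≡ χ v u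
    undirected {u} {v} g with owner g
    ... | alice a e  = trans e (trans (A.undirected a) (sym (if-yes (u ∈? neighbours A v) (Graph.~-sym A a))))
    ... | bob b ¬a e = trans e (trans (B.undirected b) (sym (if-no (u ∈? neighbours A v) (¬a ∘ Graph.~-sym A))))
    in-palette : ∀ {u v} → v ∈ neighbours G u → χ u v < k
    in-palette g with owner g
    ... | alice a e = subst (_< k) (sym e) (A.in-palette a)
    ... | bob b _ e = subst (_< k) (sym e) (B.in-palette b)
    proper : ∀ {u v w} → v ∈ neighbours G u → w ∈ neighbours G u → v ≢ w → χ u v ≢ χ u w
    proper g h v≢w q with owner g | owner h
    ... | alice a e | alice b f = A.proper a b v≢w (trans (sym e) (trans q f))
    ... | alice a e | bob b _ f = cross a b (trans (sym e) (trans q f))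
    ... | bob a _ e | alice b f = cross b a (trans (sym f) (trans (sym q) e))
    ... | bob a _ e | bob b _ f = B.proper a b v≢w (trans (sym e) (trans q f))

colourOf : ∀ {n k} {E : Fin k → Fin n → Fin n → Set} → Colouring k E → EdgeColours n
colourOf C u v with covered? C u v
... | yes (c , _) = toℕ c
... | no _        = 0

colourOf-covered : ∀ {n k} {E : Fin k → Fin n → Fin n → Set} (C : Colouring k E) {u v} →
                   Covered C u v → ∃[ c ] mate C c u ≡ v × colourOf C u v ≡ toℕ c
colourOf-covered C {u} {v} cov with covered? C u v
... | yes (c , e) = c , e , refl
... | no ¬cov     = contradiction cov ¬cov

colourOf-proper : ∀ {n k} {E : Fin k → Fin n → Fin n → Set} (G : Graph n) (C : Colouring k E) →
  (∀ {u v} → v ∈ neighbours G u → Covered C u v) → IsProperEdgeColouring G k (colourOf C)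
colourOf-proper {k = k} G C total = record
  { undirected = λ a → undirected a (total a) (total (Graph.~-sym G a))
  ; in-palette = λ a → let c , _ , e = colourOf-covered C (total a) in subst (_< k) (sym e) (toℕ<n c)
  ; proper     = λ a b v≢w q →
      let c , e , f = colourOf-covered C (total a)
          d , g , h = colourOf-covered C (total b)
      in v≢w (trans (sym e) (trans (cong (λ c → mate C c _) (toℕ-injective (trans (sym f) (trans q h)))) g))
  }
  where
  undirected : ∀ {u v} → v ∈ neighbours G u → Covered C u v → Covered C v u →
               colourOf C u v ≡ colourOf C v u
  undirected {u} {v} a p q with colourOf-covered C p | colourOf-covered C q
  ... | c , e , f | d , g , h = trans f (trans (cong toℕ (disjoint C (trans e (sym (swap-mate C g)))
        (λ m → adj⇒≢ (toDecGraph G) a (trans (sym m) e)))) (sym h))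

-- The one-way greedy protocol for small maximum degree.

module SmallDegree (n Δ : ℕ) where

  k : ℕ
  k = 2 * Δ ∸ 1

  unforbidden? : (c : Fin k) (v : Fin n) → Dec ⊥
  unforbidden? _ _ = no id

  colouringA : (A : Graph n) → Colouring k (Allowed k (toDecGraph A) unforbidden?)
  colouringA A = proj₁ (greedy k (toDecGraph A) unforbidden?)

  usage : Graph n → Fin k → Fin n → ℕ
  usage A c v = indicator (used? (colouringA A) v c)

  busy? : (heard : Fin k → Fin n → ℕ) → ∀ c v → Dec (heard c v ≢ 0)
  busy? heard c v = ¬? (heard c v ℕ.≟ 0)

  colouringB : (heard : Fin k → Fin n → ℕ) (B : Graph n) → Colouring k (Allowed k (toDecGraph B) (busy? heard))
  colouringB heard B = proj₁ (greedy k (toDecGraph B) (busy? heard))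

  protocol : EdgeColouringProtocol n
  protocol = round (λ A → encode (usage A)) (λ _ → []) λ a _ →
    output (λ A → colourOf (colouringA A)) (λ B → colourOf (colouringB (decode k n a) B))

  communication≤ : ∀ A B → communication protocol A B ≤ k * (n + n)
  communication≤ A B = begin
    length (encode (usage A)) + 0 + 0      ≡⟨ trans (ℕ.+-identityʳ _) (ℕ.+-identityʳ _) ⟩
    length (encode (usage A))              ≡⟨ length-encode (usage A) ⟩
    sum (λ c → sum (usage A c) + n)        ≤⟨ sum≤n*m (λ c → ℕ.+-monoˡ-≤ n (sum-indicator≤ (λ v → used? (colouringA A) v c))) ⟩
    k * (n + n)                            ∎
    where open ℕ.≤-Reasoning

  module _ {G A B : Graph n} (degree≡ : maxDegree G ≡ Δ) (partition : IsEdgePartition G A B) where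

    private
      a b : Fin n → ℕ
      a = deg (toDecGraph A)
      b = deg (toDecGraph B)

      heard : Fin k → Fin n → ℕ
      heard = decode k n (encode (usage A))

      a+b≤Δ : ∀ v → a v + b v ≤ Δ
      a+b≤Δ v = ℕ.≤-trans (deg-partition partition v)
        (ℕ.≤-trans (deg≤maxDegree G v) (ℕ.≤-reflexive degree≡))

      -- Loads of at most `Δ` are exactly what `greedy` allows, since `2 * Δ ≤ suc k`; with
      -- truncated subtraction this includes `Δ = 0`.
      fits : ∀ {i j} → i ≤ Δ → j ≤ Δ → i + j ≤ suc k
      fits i≤Δ j≤Δ = ℕ.≤-trans (ℕ.+-mono-≤ i≤Δ j≤Δ)
        (ℕ.≤-trans (ℕ.≤-reflexive (cong (Δ +_) (sym (ℕ.+-identityʳ Δ)))) (ℕ.m≤n+m∸n (2 * Δ) 1))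

      loadA≤ : ∀ v → load k (toDecGraph A) unforbidden? v ≤ Δ
      loadA≤ v = ℕ.≤-trans (ℕ.+-monoˡ-≤ (a v)
          (ℕ.≤-trans (sum≤n*m {k} {0} (λ _ → z≤n)) (ℕ.≤-reflexive (ℕ.*-zeroʳ k))))
        (ℕ.≤-trans (ℕ.m≤m+n (a v) (b v)) (a+b≤Δ v))

      busy⇒used : ∀ c v → heard c v ≢ 0 → ¬ Missing (colouringA A) c v
      busy⇒used c v ne m = ne (trans (decode-encode (usage A) c v)
        (indicator-no (used? (colouringA A) v c) (λ u → u m)))

      used⇒busy : ∀ c v → ¬ Missing (colouringA A) c v → heard c v ≢ 0
      used⇒busy c v u z = contradiction (trans (sym z) (trans (decode-encode (usage A) c v)
        (indicator-yes (used? (colouringA A) v c) u))) λ ()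

      -- A colour forbidden to Bob at `v` is used there by an edge of Alice, so the load is at most
      -- the sum of the two degrees.
      loadB≤ : ∀ v → load k (toDecGraph B) (busy? heard) v ≤ Δ
      loadB≤ v = ℕ.≤-trans (ℕ.+-monoˡ-≤ (b v)
          (ℕ.≤-trans (count-mono (λ c → busy? heard c v) (used? (colouringA A) v) (λ c → busy⇒used c v))
                     (used≤deg (toDecGraph A) proj₁ (colouringA A) v)))
        (a+b≤Δ v)

      coverA : ∀ {u v} → v ∈ neighbours A u → Covered (colouringA A) u v
      coverA e = proj₂ (greedy k (toDecGraph A) unforbidden?) e (fits (loadA≤ _) (loadA≤ _))

      coverB : ∀ {u v} → v ∈ neighbours B u → Covered (colouringB heard B) u v
      coverB e = proj₂ (greedy k (toDecGraph B) (busy? heard)) e (fits (loadB≤ _) (loadB≤ _))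

      cross : ∀ {u v w} → v ∈ neighbours A u → w ∈ neighbours B u →
              colourOf (colouringA A) u v ≢ colourOf (colouringB heard B) u w
      cross {u} {v} {w} e f q with colourOf-covered (colouringA A) (coverA e)
                                 | colourOf-covered (colouringB heard B) (coverB f)
      ... | c , p , cc | d , r , dd with toℕ-injective (trans (sym cc) (trans q dd))
      ...   | refl = proj₁ (proj₂ (sound (colouringB heard B) {c} {u}
                       (λ m → adj⇒≢ (toDecGraph B) f (trans (sym m) r))))
                     (used⇒busy c u (λ m → adj⇒≢ (toDecGraph A) e (trans (sym m) p)))

    solves : Solves protocol k G A B
    solves = combine-proper partition (colourOf-proper A (colouringA A) coverA)
      (colourOf-proper B (colouringB heard B) coverB) cross

-- Numbering the hues, and the protocol for maximum degree at least four.

flip : Hue → Hue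
flip (own j)   = other j
flip (other j) = own j
flip shared    = shared

flip-injective : ∀ {h h′} → flip h ≡ flip h′ → h ≡ h′
flip-injective {own _}   {own _}   refl = refl
flip-injective {other _} {other _} refl = refl
flip-injective {shared}  {shared}  refl = refl

-- Alice's palette is followed by Bob's and then by the shared colour; Bob paints
-- with flipped hues.
paint : ℕ → Hue → ℕ
paint M (own j)   = j
paint M (other j) = M + j
paint M shared    = M + M

data Valid (M : ℕ) : Hue → Set where
  own    : ∀ {j} → j < M → Valid M (own j)
  other  : ∀ {j} → j < M → Valid M (other j)
  shared : Valid M shared

flip-valid : ∀ {M h} → Valid M h → Valid M (flip h)
flip-valid (own p)   = other p
flip-valid (other p) = own p
flip-valid shared    = shared

paint< : ∀ {M h} → Valid M h → paint M h < suc (M + M)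
paint< {M} (own p)   = s≤s (ℕ.≤-trans (ℕ.<⇒≤ p) (ℕ.m≤m+n M M))
paint< {M} (other p) = s≤s (ℕ.+-monoʳ-≤ M (ℕ.<⇒≤ p))
paint< {M} shared    = ℕ.≤-refl

paint-injective : ∀ {M h h′} → Valid M h → Valid M h′ → paint M h ≡ paint M h′ → h ≡ h′
paint-injective {M} (own _)   (own _)   e = cong own e
paint-injective {M} (own p)   (other _) e = contradiction p (ℕ.≤⇒≯ (ℕ.≤-trans (ℕ.m≤m+n M _) (ℕ.≤-reflexive (sym e))))
paint-injective {M} (own p)   shared    e = contradiction p (ℕ.≤⇒≯ (ℕ.≤-trans (ℕ.m≤m+n M _) (ℕ.≤-reflexive (sym e))))
paint-injective {M} (other _) (own p)   e = contradiction p (ℕ.≤⇒≯ (ℕ.≤-trans (ℕ.m≤m+n M _) (ℕ.≤-reflexive e)))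
paint-injective {M} shared    (own p)   e = contradiction p (ℕ.≤⇒≯ (ℕ.≤-trans (ℕ.m≤m+n M _) (ℕ.≤-reflexive e)))
paint-injective {M} (other _) (other _) e = cong other (ℕ.+-cancelˡ-≡ M _ _ e)
paint-injective {M} (other p) shared    e = contradiction (ℕ.+-cancelˡ-≡ M _ _ e) (ℕ.<⇒≢ p)
paint-injective {M} shared    (other p) e = contradiction (ℕ.+-cancelˡ-≡ M _ _ (sym e)) (ℕ.<⇒≢ p)
paint-injective {M} shared    shared    e = refl

module _ {n K : ℕ} {G H : DecGraph n} (P : Plan G (3 + K)) (Q : Plan H (3 + K))
         (heardP heardQ : Fin 4 → Fin n → ℕ)
         (truthfulP : ∀ i v → heardP i v ≡ report Q i v)
         (truthfulQ : ∀ i v → heardQ i v ≡ report P i v)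
         (degrees : ∀ v → deg G v + deg H v ≤ 4 + K) where

  private
    degrees′ : ∀ v → deg H v + deg G v ≤ 4 + K
    degrees′ v = ℕ.≤-trans (ℕ.≤-reflexive (ℕ.+-comm (deg H v) (deg G v))) (degrees v)

    conflict : ∀ {E : Fin n → Fin n → Set} {j u} (C : Colouring (3 + K) (λ _ → E)) →
      (∃[ c ] toℕ c ≡ j × ¬ Missing C c u) → ¬ (∃[ c ] toℕ c ≡ j × Missing C c u)
    conflict C (c , e , used) (d , f , m) with toℕ-injective (trans e (sym f))
    ... | refl = used m

  HueOf-valid : ∀ {u v h} → HueOf P heardP u v h → Valid (3 + K) h
  HueOf-valid {h = own j}   p = let c , e , _ = HueOf-own P heardP p refl
                                in own (subst (_< 3 + K) e (toℕ<n c))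
  HueOf-valid {h = other j} p = let c , e , _ = HueOf-other P heardP Q truthfulP degrees p refl
                                in other (subst (_< 3 + K) e (toℕ<n c))
  HueOf-valid {h = shared}  p = shared

  -- An own colour of one party is used in its colouring at `u`, whereas a colour borrowed from it
  -- is missing there. This leaves the shared colour on both sides.
  HueOf-cross : ∀ {u v w h h′} → Adj G u v → Adj H u w →
                HueOf P heardP u v h → HueOf Q heardQ u w h′ → h ≢ flip h′
  HueOf-cross {h′ = other j} _ _ p q refl = conflict (Plan.colouring P)
    (HueOf-own P heardP p refl) (HueOf-other Q heardQ P truthfulQ degrees′ q refl)
  HueOf-cross {h′ = own j} _ _ p q refl = conflict (Plan.colouring Q)
    (HueOf-own Q heardQ q refl) (HueOf-other P heardP Q truthfulP degrees p refl)
  HueOf-cross {u} {v} {w} {h′ = shared} a b p q refl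
    with HueOf-shared P heardP p refl | HueOf-shared Q heardQ q refl
  ... | inj₁ full | _ = ℕ.m+1+n≰m (4 + K) (ℕ.≤-trans
          (ℕ.≤-trans (ℕ.+-monoʳ-≤ (4 + K) (count-positive (adj? H u) b))
                     (ℕ.≤-reflexive (cong (_+ deg H u) (sym full)))) (degrees u))
  ... | inj₂ _ | inj₁ full = ℕ.m+1+n≰m (4 + K) (ℕ.≤-trans
          (ℕ.≤-trans (ℕ.+-monoʳ-≤ (4 + K) (count-positive (adj? G u) a))
                     (ℕ.≤-reflexive (cong (_+ deg G u) (sym full)))) (degrees′ u))
  -- Without offers at `u`, both rests have at least half of `3 + K` edges there, so
  -- `3 + K ≤ r + s`. Each party also has a leftover edge at `u`, so `r + s + 2 ≤ 4 + K`, a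
  -- contradiction.
  ... | inj₂ (noOfferQ , p<) | inj₂ (noOfferP , q<) = ℕ.<-irrefl refl (begin-strict
    3 + K + (3 + K)                  ≤⟨ ℕ.+-mono-≤ (Plan.silent P (trans (sym (truthfulQ zero u)) noOfferP))
                                                   (Plan.silent Q (trans (sym (truthfulP zero u)) noOfferQ)) ⟩
    2 * r + 2 * s                    ≡⟨ sym (ℕ.*-distribˡ-+ 2 r s) ⟩
    2 * (r + s)                      ≤⟨ ℕ.*-monoʳ-≤ 2 (s≤s⁻¹ (s≤s⁻¹ (ℕ.≤-trans
                                          (ℕ.≤-reflexive (sym (cong suc (ℕ.+-suc r s))))
                                          (ℕ.≤-trans (ℕ.+-mono-≤ p< q<) (degrees u))))) ⟩
    2 * (2 + K)                      ≡⟨ cong (2 + K +_) (ℕ.+-identityʳ (2 + K)) ⟩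
    2 + K + (2 + K)                  <⟨ ℕ.+-mono-<-≤ (ℕ.n<1+n (2 + K)) (ℕ.n≤1+n (2 + K)) ⟩
    3 + K + (3 + K)                  ∎)
    where
    open ℕ.≤-Reasoning
    r s : ℕ
    r = deg (Plan.rest P) u
    s = deg (Plan.rest Q) u

module LargeDegree (n K : ℕ) where

  k : ℕ
  k = 2 * (4 + K) ∸ 1

  k≡ : k ≡ suc (3 + K + (3 + K))
  k≡ = trans (cong (λ m → 3 + K + m) (ℕ.+-identityʳ (4 + K))) (ℕ.+-suc (3 + K) (3 + K))

  -- A protocol must act on every pair of inputs, while plans exist only under the degree bound that
  -- the partition promises. Each party therefore tests its own graph and falls back on an empty
  -- message and a constant colour.
  Bounded : Graph n → Set
  Bounded X = ∀ u → deg (toDecGraph X) u ≤ 4 + K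

  bounded? : ∀ X → Dec (Bounded X)
  bounded? X = all? (λ u → deg (toDecGraph X) u ℕ.≤? 4 + K)

  planOf : ∀ X → Bounded X → Plan (toDecGraph X) (3 + K)
  planOf X = plan (toDecGraph X) (3 + K)

  say : ∀ X → Dec (Bounded X) → Message
  say X (yes b) = encode (report (planOf X b))
  say X (no _)  = []

  colour : (Hue → Hue) → Message → ∀ X → Dec (Bounded X) → EdgeColours n
  colour φ ms X (yes b) u v = paint (3 + K) (φ (hue (planOf X b) (decode 4 n ms) u v))
  colour φ ms X (no _)  _ _ = 0

  protocol : EdgeColouringProtocol n
  protocol = round (λ A → say A (bounded? A)) (λ B → say B (bounded? B)) λ a b →
    output (λ A → colour id b A (bounded? A)) (λ B → colour flip a B (bounded? B))

  say≤ : ∀ X b → length (say X b) ≤ 9 * n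
  say≤ X (no _)  = z≤n
  -- The offers take `2 * n` plus `n` closing bits; each of the three rows of usage bits takes at
  -- most `n + n`.
  say≤ X (yes b) = begin
    length (encode (report P))                         ≡⟨ length-encode (report P) ⟩
    sum (λ i → sum (report P i) + n)                   ≤⟨ ℕ.+-mono-≤ (ℕ.+-monoˡ-≤ n (Plan.cheap P))
                                                           (sum≤n*m {3} {n + n} (λ c → ℕ.+-monoˡ-≤ n
                                                             (sum-indicator≤ (λ v → used? (Plan.colouring P) v (c ↑ˡ K))))) ⟩
    2 * n + n + 3 * (n + n)                            ≡⟨ solve 1 (λ n → con 2 :* n :+ n :+ con 3 :* (n :+ n) := con 9 :* n) refl n ⟩
    9 * n                                              ∎
    where
    open ℕ.≤-Reasoning
    P : Plan (toDecGraph X) (3 + K)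
    P = planOf X b

  communication≤ : ∀ A B → communication protocol A B ≤ 18 * n
  communication≤ A B = begin
    length (say A (bounded? A)) + length (say B (bounded? B)) + 0  ≡⟨ ℕ.+-identityʳ _ ⟩
    length (say A (bounded? A)) + length (say B (bounded? B))      ≤⟨ ℕ.+-mono-≤ (say≤ A (bounded? A)) (say≤ B (bounded? B)) ⟩
    9 * n + 9 * n                                                  ≡⟨ sym (ℕ.*-distribʳ-+ n 9 9) ⟩
    18 * n                                                         ∎
    where open ℕ.≤-Reasoning

  module _ {G A B : Graph n} (degree≡ : maxDegree G ≡ 4 + K) (partition : IsEdgePartition G A B) where

    private
      degrees : ∀ v → deg (toDecGraph A) v + deg (toDecGraph B) v ≤ 4 + K
      degrees v = ℕ.≤-trans (deg-partition partition v)
        (ℕ.≤-trans (deg≤maxDegree G v) (ℕ.≤-reflexive degree≡))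

      boundedA : Bounded A
      boundedA v = ℕ.≤-trans (ℕ.m≤m+n _ _) (degrees v)

      boundedB : Bounded B
      boundedB v = ℕ.≤-trans (ℕ.m≤n+m _ _) (degrees v)

      party-proper : ∀ X {Y} (P : Plan (toDecGraph X) (3 + K)) (Q : Plan Y (3 + K))
        (heard : Fin 4 → Fin n → ℕ) → (∀ i v → heard i v ≡ report Q i v) →
        (∀ v → deg (toDecGraph X) v + deg Y v ≤ 4 + K) →
        (φ : Hue → Hue) → (∀ {h} → Valid (3 + K) h → Valid (3 + K) (φ h)) →
        (∀ {h h′} → φ h ≡ φ h′ → h ≡ h′) →
        IsProperEdgeColouring X k (λ u v → paint (3 + K) (φ (hue P heard u v)))
      party-proper X P Q heard truthful bound φ φ-valid φ-injective = record
        { undirected = λ a → cong (paint (3 + K) ∘ φ)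
            (HueOf-unique P heard (at a) (HueOf-sym P heard (at (Graph.~-sym X a))))
        ; in-palette = λ a → ℕ.≤-trans (paint< (φ-valid (valid a))) (ℕ.≤-reflexive (sym k≡))
        ; proper     = λ a b v≢w e → v≢w (HueOf-proper P heard (at a) (at b)
            (φ-injective (paint-injective (φ-valid (valid a)) (φ-valid (valid b)) e)))
        }
        where
        at : ∀ {u v} → v ∈ neighbours X u → HueOf P heard u v (hue P heard u v)
        at = hue-correct P heard (fits-truthful P heard Q truthful bound)
        valid : ∀ {u v} → v ∈ neighbours X u → Valid (3 + K) (hue P heard u v)
        valid a = HueOf-valid P Q heard (report P) truthful (λ _ _ → refl) bound (at a)

      solves′ : ∀ dA dB → IsProperEdgeColouring G k
        (combine A (colour id (say B dB) A dA) (colour flip (say A dA) B dB))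
      solves′ (no ¬b) _       = contradiction boundedA ¬b
      solves′ (yes _) (no ¬b) = contradiction boundedB ¬b
      solves′ (yes bA) (yes bB) = combine-proper partition
        (party-proper A P Q heardP truthfulP degrees id id id)
        (party-proper B Q P heardQ truthfulQ degrees′ flip flip-valid flip-injective)
        λ {u} {v} {w} a b e → HueOf-cross P Q heardP heardQ truthfulP truthfulQ degrees a b (atP a) (atQ b)
          (paint-injective
            (HueOf-valid P Q heardP heardQ truthfulP truthfulQ degrees (atP a))
            (flip-valid (HueOf-valid Q P heardQ heardP truthfulQ truthfulP degrees′ (atQ b))) e)
        where
        P = planOf A bA
        Q = planOf B bB
        heardP heardQ : Fin 4 → Fin n → ℕ
        heardP = decode 4 n (encode (report Q))
        heardQ = decode 4 n (encode (report P))
        truthfulP = decode-encode (report Q)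
        truthfulQ = decode-encode (report P)
        degrees′ : ∀ v → deg (toDecGraph B) v + deg (toDecGraph A) v ≤ 4 + K
        degrees′ v = ℕ.≤-trans (ℕ.≤-reflexive (ℕ.+-comm _ (deg (toDecGraph A) v))) (degrees v)
        atP : ∀ {u v} → v ∈ neighbours A u → HueOf P heardP u v (hue P heardP u v)
        atP = hue-correct P heardP (fits-truthful P heardP Q truthfulP degrees)
        atQ : ∀ {u v} → v ∈ neighbours B u → HueOf Q heardQ u v (hue Q heardQ u v)
        atQ = hue-correct Q heardQ (fits-truthful Q heardQ P truthfulQ degrees′)

    solves : Solves protocol k G A B
    solves = solves′ (bounded? A) (bounded? B)

theorem2 : Σ[ c ∈ ℕ ] Σ[ r ∈ ℕ ]
    ((n Δ : ℕ) →
    Σ[ P ∈ EdgeColouringProtocol n ]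
    ((G A B : Graph n) → maxDegree G ≡ Δ → IsEdgePartition G A B →
    Solves P (2 * Δ ∸ 1) G A B
    × communication P A B ≤ c * n
    × rounds P A B ≤ r))
-- The constant comes from two messages of at most `9 * n` bits. For `Δ ≤ 3` there are at most five
-- colours, each with a row of at most `n + n` bits, so nine such rows are a sufficient bound within
-- the same constant.
theorem2 = 18 , 1 , choose
  where
  small : ∀ n Δ → 2 * Δ ∸ 1 ≤ 9 → Σ[ P ∈ EdgeColouringProtocol n ]
    ((G A B : Graph n) → maxDegree G ≡ Δ → IsEdgePartition G A B →
    Solves P (2 * Δ ∸ 1) G A B × communication P A B ≤ 18 * n × rounds P A B ≤ 1)
  small n Δ k≤9 = protocol , λ G A B d p → solves d p ,
    ℕ.≤-trans (communication≤ A B) (ℕ.≤-trans (ℕ.*-monoˡ-≤ (n + n) k≤9)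
      (ℕ.≤-reflexive (solve 1 (λ n → con 9 :* (n :+ n) := con 18 :* n) refl n))) , ℕ.≤-refl
    where open SmallDegree n Δ
  choose : ∀ n Δ → Σ[ P ∈ EdgeColouringProtocol n ]
    ((G A B : Graph n) → maxDegree G ≡ Δ → IsEdgePartition G A B →
    Solves P (2 * Δ ∸ 1) G A B × communication P A B ≤ 18 * n × rounds P A B ≤ 1)
  choose n 0 = small n 0 z≤n
  choose n 1 = small n 1 (s≤s z≤n)
  choose n 2 = small n 2 (s≤s (s≤s (s≤s z≤n)))
  choose n 3 = small n 3 (s≤s (s≤s (s≤s (s≤s (s≤s z≤n)))))
  choose n (suc (suc (suc (suc K)))) =
    protocol , λ G A B d p → solves d p , communication≤ A B , ℕ.≤-refl
    where open LargeDegree n K
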